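{- Let $G=(V,E)$ be a finite connected graph (parallel edges allowed, no loops) with at least two vertices. Let $F$ be a two-forest of $G$ chosen uniformly at random among all two-forests of $G$, and let $\partial F$ be its cut set. Then \[ \mathbb{E}(|\partial F|) \;\leq\; 2\,(\mathrm{avg.deg})\left(1+\frac{1}{|V|-1}\right), \] where $\mathrm{avg.deg} = \frac{1}{|V|}\sum_{v\in V}\deg v = 2|E|/|V|$ is the average degree of $G$.
   Context: A two-forest of $G$ is a spanning subgraph with no cycles having exactly two connected components. If the components of a two-forest $F$ have vertex sets $A$ and $B$ (so $V=A\sqcup B$), the cut set $\partial F$ is the set of edges of $G$ with one endpoint in $A$ and the other in $B$. -}

module Defs where

open import Data.Nat using (ℕ; _≤_)
open import Data.Fin using (Fin)
open import Data.Fin.Subset using (Subset; _∈_)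
open import Data.List using (List; []; _∷_; length)
open import Data.List.Membership.Propositional using () renaming (_∈_ to _∈ˡ_)
open import Data.List.Relation.Unary.Unique.Propositional using (Unique)
open import Data.Product using (Σ; ∃; ∃₂; _×_; _,_)
open import Data.Sum using (_⊎_)
open import Relation.Binary.PropositionalEquality using (_≡_; _≢_)
open import Relation.Nullary using (¬_)
open import Function.Bundles using (_⇔_)

-- A finite multigraph (parallel edges allowed, no loops) with vertex set
-- Fin n and edge set Fin m; edge e joins src e and tgt e (undirected).
record Multigraph (n m : ℕ) : Set where
  field
    src      : Fin m → Fin n
    tgt      : Fin m → Fin n
    loopless : ∀ e → src e ≢ tgt e

module _ {n m : ℕ} (G : Multigraph n m) where
  open Multigraph G

  Joins : Fin m → Fin n → Fin n → Set
  Joins e u w = (src e ≡ u × tgt e ≡ w) ⊎ (src e ≡ w × tgt e ≡ u)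

  data Walk (S : Subset m) : Fin n → Fin n → List (Fin m) → Set where
    nil  : ∀ {u} → Walk S u u []
    cons : ∀ {u w v e es} → e ∈ S → Joins e u w → Walk S w v es →
           Walk S u v (e ∷ es)

  Conn : Subset m → Fin n → Fin n → Set
  Conn S u v = ∃ λ es → Walk S u v es

  HasCycle : Subset m → Set
  HasCycle S = ∃₂ λ v es → Walk S v v es × Unique es × es ≢ []

  Acyclic : Subset m → Set
  Acyclic S = ¬ HasCycle S

  TwoComponents : Subset m → Set
  TwoComponents S = ∃₂ λ a b → ¬ Conn S a b × (∀ v → Conn S a v ⊎ Conn S b v)

  IsTwoForest : Subset m → Set
  IsTwoForest S = Acyclic S × TwoComponents S

  InCut : Subset m → Fin m → Set
  InCut S e = ¬ Conn S (src e) (tgt e)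

  Connected : Set
  Connected = ∀ u v → Conn Data.Fin.Subset.⊤ u v

Enumerates : {A : Set} → (A → Set) → List A → Set
Enumerates P xs = Unique xs × (∀ x → (x ∈ˡ xs) ⇔ P x)

HasSize : {A : Set} → (A → Set) → ℕ → Set
HasSize P k = Σ _ λ xs → Enumerates P xs × length xs ≡ k

{-# OPTIONS --safe #-}
module Submission where

-- Fix a root q, let τ be the number of spanning trees and φ the number of two-forests, let t(a,b) count the
-- two-forests separating a from b, let g(x,y) count those separating q from {x,y}, and put R(x) = g(x,x).
-- Counting pairs (F, e) with e ∈ ∂F gives Σ_F |∂F| = Σ_e t(e), which also equals (n − 1) τ.
-- Detaching the parent edge of x in a rooted forest shows that g(·,y)/τ is the Green function of the graph
-- Laplacian.  Hence t(a,b) = R(a) + R(b) − 2 g(a,b) and, by uniqueness in a Dirichlet problem,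
-- τ · #{three-forests separating q, a, b} = R(a) R(b) − g(a,b)².
-- The component of a two-forest avoiding q is a tree, so φ ≥ Σ_x R(x) − Σ_{e=ab} #{three-forests separating q, a, b}.
-- Combining these, 4τφ ≥ Σ_{e=ab} (t(e)² + 3 (R(a) − R(b))²) ≥ Σ_e t(e)², and Cauchy–Schwarz gives
-- (n − 1) τ Σ_F |∂F| = (Σ_e t(e))² ≤ 4 m τ φ.

open import Defs
open import Data.Nat using (ℕ)
open import Data.Fin.Subset using (Subset)
open import Data.List using (List; map; length)
open import Data.Nat.ListAction using (sum)
open import Data.List.Membership.Propositional using () renaming (_∈_ to _∈ˡ_)

-- Since (2m/n)(1 + 1/(n - 1)) = 2m/(n - 1), the claim amounts to (n - 1) Σ_F |∂F| ≤ 4mφ. The sum on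
-- the left is known exactly in terms of τ, so the difficulty is a lower bound for φ, a count that
-- the Green function does not give directly: R(x) counts only the two-forests cutting x from q, and
-- summing over x counts each of them once per vertex of the component without q. Subtracting the
-- edges of that component, one fewer than its vertices, leaves every two-forest with weight one.
-- After multiplication by τ both terms become quadratic in Green values. With a, b for R at the
-- ends of e and c for g between them, τ Σ_x R(x) is the sum over edges of a(a - c) + b(b - c): the
-- Laplacian equation at each pole x, weighted by R(x). Subtracting ab - c² leaves a² + b² + c² - ab
-- - bc - ca. Four times this form is (a + b - 2c)² + 3(a - b)², which is the origin of the 4 and of
-- the discarded squares. Working with `g` instead of g/τ keeps every quantity an integer, and both
-- Laplacian equations rest on one bijection, the removal of a parent edge, without determinants.

module Counts where
  open import Data.Bool as Bool using (true; false)
  open import Data.Nat as ℕ using (zero; suc; _<_; z≤n)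
  open import Data.Nat.Induction using (<-wellFounded)
  open import Data.Integer using (ℤ; 0ℤ; 1ℤ; _+_; _*_; _-_; _≤_; +≤+; -[1+_]; nonNegative; positive) renaming (+_ to pos)
  open import Data.Integer.Properties as ℤ using (*-assoc; *-comm; *-zeroʳ; *-zeroˡ; *-identityʳ; *-identityˡ; *-distribˡ-+; +-inverseʳ)
  open import Data.Integer.Tactic.RingSolver using (solve-∀)
  open import Data.Fin using (Fin; _≟_)
  open import Data.Fin.Properties using (all?; any?)
  open import Data.Fin.Subset using (_∈_; _∉_; _⊆_; inside; outside; ∣_∣)
  open import Data.Fin.Subset.Properties using (_∈?_; nonempty?; p⊂q⇒∣p∣<∣q∣)
  open import Data.Vec using ([]; _∷_; lookup; _[_]≔_)
  open import Data.Vec.Properties using (≡-dec; ∷-injective; []≔-idempotent; []≔-lookup; []≔-updates; []≔-minimal; []=⇒lookup; lookup⇒[]=; lookup∘updateAt; lookup∘updateAt′)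
  open import Data.List using ([]; _∷_; allFin; cartesianProductWith)
  open import Data.List.Properties using (length-tabulate)
  open import Data.List.Membership.Propositional using (find; lose) renaming (_∉_ to _∉ˡ_)
  open import Data.List.Membership.Propositional.Properties using (∈-allFin; ∈-cartesianProductWith⁺)
  open import Data.List.Relation.Unary.Any as Any using (Any; here; there)
  open import Data.List.Relation.Unary.All as All using (All; []; _∷_)
  open import Data.List.Relation.Unary.AllPairs as AllPairs using (AllPairs; []; _∷_)
  open import Data.List.Relation.Unary.Unique.Propositional using (Unique)
  open import Data.List.Relation.Unary.Unique.Propositional.Properties using (allFin⁺; cartesianProductWith⁺)
  open import Data.Product using (∃; ∃₂; _×_; _,_; proj₁; proj₂)
  open import Data.Sum as Sum using (_⊎_; inj₁; inj₂; [_,_]′)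
  open import Data.Empty using (⊥-elim)
  open import Function using (_∘_; case_of_)
  open import Function.Bundles using (Equivalence)
  open import Induction.WellFounded using (Acc; acc)
  open import Relation.Binary.Definitions using (DecidableEquality)
  open import Relation.Binary.PropositionalEquality using (_≡_; _≢_; refl; sym; trans; cong; cong₂; subst; subst₂; module ≡-Reasoning)
  open import Relation.Nullary using (¬_; Dec; yes; no; ¬?)
  open import Relation.Nullary.Decidable using (map′; _×-dec_; _⊎-dec_; _→-dec_)

  private variable
    m : ℕ
    A B P Q : Set

  -- Indicators and finite integer sums

  𝟙 : Dec P → ℤ
  𝟙 (yes _) = 1ℤ
  𝟙 (no _)  = 0ℤ

  𝟙-yes : (d : Dec P) → P → 𝟙 d ≡ 1ℤ
  𝟙-yes (yes _) _ = refl
  𝟙-yes (no ¬p) p = ⊥-elim (¬p p)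

  𝟙-no : (d : Dec P) → ¬ P → 𝟙 d ≡ 0ℤ
  𝟙-no (yes p) ¬p = ⊥-elim (¬p p)
  𝟙-no (no _)  _  = refl

  𝟙≥0 : (d : Dec P) → 0ℤ ≤ 𝟙 d
  𝟙≥0 (yes _) = +≤+ z≤n
  𝟙≥0 (no _)  = ℤ.≤-refl

  𝟙-mono : (d : Dec P) (e : Dec Q) → (P → Q) → 𝟙 d ≤ 𝟙 e
  𝟙-mono (yes p) e f = ℤ.≤-reflexive (sym (𝟙-yes e (f p)))
  𝟙-mono (no _)  e _ = 𝟙≥0 e

  𝟙-cong : (d : Dec P) (e : Dec Q) → (P → Q) → (Q → P) → 𝟙 d ≡ 𝟙 e
  𝟙-cong d e f g = ℤ.≤-antisym (𝟙-mono d e f) (𝟙-mono e d g)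

  𝟙-× : {P×Q : Set} (d : Dec P) (e : Dec Q) (r : Dec P×Q) → (P×Q → P × Q) → (P → Q → P×Q) → 𝟙 d * 𝟙 e ≡ 𝟙 r
  𝟙-× (yes p) (yes q) r f g = sym (𝟙-yes r (g p q))
  𝟙-× (yes p) (no ¬q) r f g = sym (𝟙-no r λ x → let (_ , q) = f x in ¬q q)
  𝟙-× (no ¬p) e       r f g = trans (*-zeroˡ (𝟙 e)) (sym (𝟙-no r λ x → let (p , _) = f x in ¬p p))

  -- Lets a summand be rewritten under the hypothesis that its indicator tests, although the sum
  -- runs over everything.
  𝟙-guard : (d : Dec P) {x y : ℤ} → (P → x ≡ y) → 𝟙 d * x ≡ 𝟙 d * y
  𝟙-guard (yes p) eq = cong (1ℤ *_) (eq p)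
  𝟙-guard (no _)  {x} {y} _  = trans (*-zeroˡ x) (sym (*-zeroˡ y))

  ∑ : List A → (A → ℤ) → ℤ
  ∑ []       f = 0ℤ
  ∑ (x ∷ xs) f = f x + ∑ xs f

  ∑-cong : (xs : List A) {f g : A → ℤ} → (∀ x → f x ≡ g x) → ∑ xs f ≡ ∑ xs g
  ∑-cong []       eq = refl
  ∑-cong (x ∷ xs) eq = cong₂ _+_ (eq x) (∑-cong xs eq)

  ∑-mono : (xs : List A) {f g : A → ℤ} → (∀ x → f x ≤ g x) → ∑ xs f ≤ ∑ xs g
  ∑-mono []       le = ℤ.≤-refl
  ∑-mono (x ∷ xs) le = ℤ.+-mono-≤ (le x) (∑-mono xs le)

  ∑-zero : (xs : List A) → ∑ xs (λ _ → 0ℤ) ≡ 0ℤ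
  ∑-zero []       = refl
  ∑-zero (x ∷ xs) = trans (ℤ.+-identityˡ _) (∑-zero xs)

  ∑-nonneg : (xs : List A) {f : A → ℤ} → (∀ x → 0ℤ ≤ f x) → 0ℤ ≤ ∑ xs f
  ∑-nonneg xs {f} le = subst (_≤ ∑ xs f) (∑-zero xs) (∑-mono xs le)

  ∑-+ : (xs : List A) (f g : A → ℤ) → ∑ xs (λ x → f x + g x) ≡ ∑ xs f + ∑ xs g
  ∑-+ []       f g = refl
  ∑-+ (x ∷ xs) f g = trans (cong ((f x + g x) +_) (∑-+ xs f g)) (shuffle (f x) (g x) _ _)
    where
    shuffle : ∀ a b c d → (a + b) + (c + d) ≡ (a + c) + (b + d)
    shuffle = solve-∀

  ∑-*ˡ : (xs : List A) (k : ℤ) (f : A → ℤ) → ∑ xs (λ x → k * f x) ≡ k * ∑ xs f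
  ∑-*ˡ []       k f = sym (*-zeroʳ k)
  ∑-*ˡ (x ∷ xs) k f = trans (cong (k * f x +_) (∑-*ˡ xs k f)) (sym (*-distribˡ-+ k (f x) _))

  ∑-*ʳ : (xs : List A) (k : ℤ) (f : A → ℤ) → ∑ xs (λ x → f x * k) ≡ ∑ xs f * k
  ∑-*ʳ xs k f = trans (∑-cong xs (λ x → *-comm (f x) k)) (trans (∑-*ˡ xs k f) (*-comm k _))

  ∑-- : (xs : List A) (f g : A → ℤ) → ∑ xs (λ x → f x - g x) ≡ ∑ xs f - ∑ xs g
  ∑-- []       f g = refl
  ∑-- (x ∷ xs) f g = trans (cong ((f x - g x) +_) (∑-- xs f g)) (shuffle (f x) (g x) _ _)
    where
    shuffle : ∀ a b c d → (a - b) + (c - d) ≡ (a + c) - (b + d)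
    shuffle = solve-∀

  ∑-swap : (xs : List A) (ys : List B) (f : A → B → ℤ) →
           ∑ xs (λ x → ∑ ys (f x)) ≡ ∑ ys (λ y → ∑ xs (λ x → f x y))
  ∑-swap []       ys f = sym (∑-zero ys)
  ∑-swap (x ∷ xs) ys f = trans (cong (∑ ys (f x) +_) (∑-swap xs ys f)) (sym (∑-+ ys (f x) _))

  ∑-∈-≤ : (xs : List A) {f : A → ℤ} → (∀ x → 0ℤ ≤ f x) → ∀ {x} → x ∈ˡ xs → f x ≤ ∑ xs f
  ∑-∈-≤ (x ∷ xs) {f} le (here refl) = subst (_≤ f x + ∑ xs f) (ℤ.+-identityʳ (f x)) (ℤ.+-monoʳ-≤ (f x) (∑-nonneg xs le))
  ∑-∈-≤ (y ∷ xs) {f} le {x} (there i) = ℤ.≤-trans (∑-∈-≤ xs le i)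
    (subst (_≤ f y + ∑ xs f) (ℤ.+-identityˡ (∑ xs f)) (ℤ.+-monoˡ-≤ (∑ xs f) (le y)))

  ∑-none : {Q : A → Set} (Q? : ∀ x → Dec (Q x)) (xs : List A) → All (λ x → ¬ Q x) xs → ∑ xs (λ x → 𝟙 (Q? x)) ≡ 0ℤ
  ∑-none Q? []       []         = refl
  ∑-none Q? (x ∷ xs) (¬q ∷ ¬qs) = cong₂ _+_ (𝟙-no (Q? x) ¬q) (∑-none Q? xs ¬qs)

  ∑-atLeastOne : {Q : A → Set} (Q? : ∀ x → Dec (Q x)) (P? : Dec P) (xs : List A) →
                 (P → ∃ λ x → x ∈ˡ xs × Q x) → 𝟙 P? ≤ ∑ xs (λ x → 𝟙 (Q? x))
  ∑-atLeastOne Q? (no _)  xs ex = ∑-nonneg xs (λ x → 𝟙≥0 (Q? x))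
  ∑-atLeastOne Q? (yes p) xs ex = let (x , x∈ , q) = ex p in
    subst (_≤ ∑ xs (λ x → 𝟙 (Q? x))) (𝟙-yes (Q? x) q) (∑-∈-≤ xs (λ x → 𝟙≥0 (Q? x)) x∈)

  module _ {Q : A → Set} (Q? : ∀ x → Dec (Q x)) (P? : Dec P) where

    ∑-atMostOne : (xs : List A) → Unique xs → (∀ {x} → Q x → P) → (∀ {x y} → Q x → Q y → x ≡ y) →
                  ∑ xs (λ x → 𝟙 (Q? x)) ≤ 𝟙 P?
    ∑-atMostOne []       _        Q⇒P uniq = 𝟙≥0 P?
    ∑-atMostOne (x ∷ xs) (x∉ ∷ u) Q⇒P uniq with Q? x
    ... | yes q = ℤ.≤-reflexive (trans (cong (1ℤ +_) (∑-none Q? xs (All.map (λ x≢y q′ → x≢y (uniq q q′)) x∉)))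
                                     (sym (𝟙-yes P? (Q⇒P q))))
    ... | no _  = subst (_≤ 𝟙 P?) (sym (ℤ.+-identityˡ _)) (∑-atMostOne xs u Q⇒P uniq)

    ∑-exactlyOne : (xs : List A) → Unique xs → (∀ {x} → Q x → P) → (∀ {x y} → Q x → Q y → x ≡ y) →
                   (P → ∃ λ x → x ∈ˡ xs × Q x) → ∑ xs (λ x → 𝟙 (Q? x)) ≡ 𝟙 P?
    ∑-exactlyOne xs u Q⇒P uniq ex = ℤ.≤-antisym (∑-atMostOne xs u Q⇒P uniq) (∑-atLeastOne Q? P? xs ex)

  module _ (_≟_ : DecidableEquality A) where

    ∑-δ : (xs : List A) → Unique xs → (f : A → ℤ) {a : A} → a ∈ˡ xs → ∑ xs (λ x → 𝟙 (x ≟ a) * f x) ≡ f a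
    ∑-δ xs u f {a} a∈ = begin
      ∑ xs (λ x → 𝟙 (x ≟ a) * f x) ≡⟨ ∑-cong xs (λ x → 𝟙-guard (x ≟ a) (cong f)) ⟩
      ∑ xs (λ x → 𝟙 (x ≟ a) * f a) ≡⟨ ∑-*ʳ xs (f a) _ ⟩
      ∑ xs (λ x → 𝟙 (x ≟ a)) * f a
        ≡⟨ cong (_* f a) (∑-exactlyOne (_≟ a) (yes (refl {x = a})) xs u (λ _ → refl)
             (λ p q → trans p (sym q)) (λ _ → a , a∈ , refl)) ⟩
      1ℤ * f a                     ≡⟨ *-identityˡ (f a) ⟩
      f a                          ∎
      where open ≡-Reasoning

  -- Inserting and deleting one edge

  add : Fin m → Subset m → Subset m
  add g S = S [ g ]≔ inside

  del : Fin m → Subset m → Subset m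
  del g S = S [ g ]≔ outside

  module _ {g : Fin m} {S : Subset m} where

    ∈-add : g ∈ add g S
    ∈-add = []≔-updates S g

    ⊆-add : S ⊆ add g S
    ⊆-add {e} e∈ with e ≟ g
    ... | yes refl = ∈-add
    ... | no e≢g   = []≔-minimal S e g e≢g e∈

    ∈-add⁻ : ∀ e → e ∈ add g S → e ≡ g ⊎ e ∈ S
    ∈-add⁻ e e∈ with e ≟ g
    ... | yes e≡g = inj₁ e≡g
    ... | no e≢g  = inj₂ (lookup⇒[]= e S (trans (sym (lookup∘updateAt′ e g e≢g S)) ([]=⇒lookup e∈)))

    ∉-del : g ∉ del g S
    ∉-del g∈ with trans (sym ([]=⇒lookup g∈)) (lookup∘updateAt g S)
    ... | ()

    del-⊆ : del g S ⊆ S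
    del-⊆ {e} e∈ with e ≟ g
    ... | yes refl = ⊥-elim (∉-del e∈)
    ... | no e≢g   = lookup⇒[]= e S (trans (sym (lookup∘updateAt′ e g e≢g S)) ([]=⇒lookup e∈))

    ∈-del : ∀ {e} → e ∈ S → e ≢ g → e ∈ del g S
    ∈-del {e} e∈ e≢g = []≔-minimal S e g e≢g e∈

    ∈-del-or-≡ : ∀ e → e ∈ S → e ≡ g ⊎ e ∈ del g S
    ∈-del-or-≡ e e∈ with e ≟ g
    ... | yes e≡g = inj₁ e≡g
    ... | no e≢g  = inj₂ (∈-del e∈ e≢g)

    add-del : g ∈ S → add g (del g S) ≡ S
    add-del g∈ = trans ([]≔-idempotent S g)
      (trans (cong (S [ g ]≔_) (sym ([]=⇒lookup g∈))) ([]≔-lookup S g))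

    del-add : g ∉ S → del g (add g S) ≡ S
    del-add g∉ with lookup S g in eq
    ... | inside  = ⊥-elim (g∉ (lookup⇒[]= g S eq))
    ... | outside = trans ([]≔-idempotent S g)
      (trans (cong (S [ g ]≔_) (sym eq)) ([]≔-lookup S g))

  -- Walks, decidable connectivity and cycles

  module Connectivity {n m : ℕ} (G : Multigraph n m) where
    open Multigraph G

    joins-sym : ∀ {e u w} → Joins G e u w → Joins G e w u
    joins-sym (inj₁ p) = inj₂ p
    joins-sym (inj₂ p) = inj₁ p

    joins-unique : ∀ {e x u w} → Joins G e x u → Joins G e x w → u ≡ w
    joins-unique (inj₁ (p , q)) (inj₁ (r , s)) = trans (sym q) s
    joins-unique (inj₁ (p , q)) (inj₂ (r , s)) = trans (sym q) (trans s (trans (sym p) r))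
    joins-unique (inj₂ (p , q)) (inj₁ (r , s)) = trans (sym p) (trans r (trans (sym q) s))
    joins-unique (inj₂ (p , q)) (inj₂ (r , s)) = trans (sym p) r

    joins? : ∀ e u w → Dec (Joins G e u w)
    joins? e u w = ((src e ≟ u) ×-dec (tgt e ≟ w)) ⊎-dec ((src e ≟ w) ×-dec (tgt e ≟ u))

    conn-refl : ∀ {S u} → Conn G S u u
    conn-refl = [] , nil

    conn-trans : ∀ {S u v w} → Conn G S u v → Conn G S v w → Conn G S u w
    conn-trans (_ , p) q = go p q
      where
      go : ∀ {S u v w es} → Walk G S u v es → Conn G S v w → Conn G S u w
      go nil          q = q
      go (cons e j p) q = let (_ , r) = go p q in _ , cons e j r

    conn-edge : ∀ {S e u w} → e ∈ S → Joins G e u w → Conn G S u w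
    conn-edge e∈ j = _ , cons e∈ j nil

    conn-sym : ∀ {S u v} → Conn G S u v → Conn G S v u
    conn-sym (_ , p) = go p
      where
      go : ∀ {S u v es} → Walk G S u v es → Conn G S v u
      go nil          = conn-refl
      go (cons e j p) = conn-trans (go p) (conn-edge e (joins-sym j))

    conn-mono : ∀ {S T u v} → S ⊆ T → Conn G S u v → Conn G T u v
    conn-mono {S} {T} S⊆T (_ , p) = go p
      where
      go : ∀ {u v es} → Walk G S u v es → Conn G T u v
      go nil          = conn-refl
      go (cons e j p) = conn-trans (conn-edge (S⊆T e) j) (go p)

    module _ {H K : Subset m} {g : Fin m} {x w : Fin n} (K⊆H+g : ∀ e → e ∈ K → e ≡ g ⊎ e ∈ H) (j : Joins G g x w) where

      Split : Fin n → Fin n → Set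
      Split u v = Conn G H u v ⊎ (Conn G H u x × Conn G H w v) ⊎ (Conn G H u w × Conn G H x v)

      private
        step : ∀ {e u u′ v} → e ∈ K → Joins G e u u′ → Split u′ v → Split u v
        step {e} e∈ j′ s with K⊆H+g e e∈
        ... | inj₂ e∈H = let c = conn-edge e∈H j′ in
          Sum.map (conn-trans c) (Sum.map (λ (p , q) → conn-trans c p , q) (λ (p , q) → conn-trans c p , q)) s
        step {u = u} {u′} e∈ j′ s | inj₁ refl with joins-ends j j′
          where
          joins-ends : ∀ {e a b c d} → Joins G e a b → Joins G e c d → (c ≡ a × d ≡ b) ⊎ (c ≡ b × d ≡ a)
          joins-ends (inj₁ (refl , refl)) (inj₁ (refl , refl)) = inj₁ (refl , refl)
          joins-ends (inj₁ (refl , refl)) (inj₂ (refl , refl)) = inj₂ (refl , refl)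
          joins-ends (inj₂ (refl , refl)) (inj₁ (refl , refl)) = inj₂ (refl , refl)
          joins-ends (inj₂ (refl , refl)) (inj₂ (refl , refl)) = inj₁ (refl , refl)
        ... | inj₁ (refl , refl) = case s of λ where
          (inj₁ p)              → inj₂ (inj₁ (conn-refl , p))
          (inj₂ (inj₁ (_ , p))) → inj₂ (inj₁ (conn-refl , p))
          (inj₂ (inj₂ (_ , p))) → inj₁ p
        ... | inj₂ (refl , refl) = case s of λ where
          (inj₁ p)              → inj₂ (inj₂ (conn-refl , p))
          (inj₂ (inj₁ (_ , p))) → inj₁ p
          (inj₂ (inj₂ (_ , p))) → inj₂ (inj₂ (conn-refl , p))

      -- One crossing of `g` is enough: when a walk crosses `g` again, the stretch between the
      -- crossings can be discarded. The hypothesis is a mere containment, so that the lemma applies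
      -- both to `add` and to `del`.
      conn-split : ∀ {u v} → Conn G K u v → Split u v
      conn-split (_ , p) = go p
        where
        go : ∀ {u v es} → Walk G K u v es → Split u v
        go nil           = inj₁ conn-refl
        go (cons e j′ p) = step e j′ (go p)

    -- Recursion on the number of edges: removing one edge `g` reduces the question, through
    -- `conn-split`, to five questions about `del g S`.
    conn? : ∀ S u v → Dec (Conn G S u v)
    conn? S = go S (<-wellFounded ∣ S ∣)
      where
      go : ∀ S → Acc _<_ ∣ S ∣ → ∀ u v → Dec (Conn G S u v)
      go S (acc rs) u v with nonempty? S
      ... | no empty = map′ (λ { refl → conn-refl }) only-refl (u ≟ v)
        where
        only-refl : Conn G S u v → u ≡ v
        only-refl (_ , nil)        = refl
        only-refl (_ , cons e _ _) = ⊥-elim (empty (_ , e))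
      ... | yes (g , g∈) = map′ join (conn-split ∈-del-or-≡ j)
        (ih u v ⊎-dec ((ih u (src g) ×-dec ih (tgt g) v) ⊎-dec (ih u (tgt g) ×-dec ih (src g) v)))
        where
        j : Joins G g (src g) (tgt g)
        j = inj₁ (refl , refl)
        S⁻ = del g S
        ih : ∀ u v → Dec (Conn G S⁻ u v)
        ih = go S⁻ (rs (p⊂q⇒∣p∣<∣q∣ (del-⊆ , g , g∈ , ∉-del)))
        up : ∀ {u v} → Conn G S⁻ u v → Conn G S u v
        up = conn-mono del-⊆
        join : Conn G S⁻ u v ⊎ (Conn G S⁻ u (src g) × Conn G S⁻ (tgt g) v) ⊎ (Conn G S⁻ u (tgt g) × Conn G S⁻ (src g) v) → Conn G S u v
        join (inj₁ p)              = up p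
        join (inj₂ (inj₁ (p , q))) = conn-trans (up p) (conn-trans (conn-edge g∈ j) (up q))
        join (inj₂ (inj₂ (p , q))) = conn-trans (up p) (conn-trans (conn-edge g∈ (joins-sym j)) (up q))

    -- Acyclicity

    -- Acyclicity expressed by connectivity alone. In this form it is decidable by `conn?`, and its
    -- behaviour under adding or deleting an edge follows from `conn-split`.
    NoRedundantEdge : Subset m → Set
    NoRedundantEdge S = ∀ e → e ∈ S → ¬ Conn G (del e S) (src e) (tgt e)

    walk-edges : ∀ {S u v es} → Walk G S u v es → All (_∈ S) es
    walk-edges nil          = []
    walk-edges (cons e _ p) = e ∷ walk-edges p

    private
      -- Everything before the occurrence of `e` is dropped. If `e` is traversed there towards `u`,
      -- the part after it starts at `u`; otherwise the part beginning with `e` does.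
      shortcut : ∀ {S e u u′ w v es} → e ∈ˡ es → Joins G e u u′ → Walk G S w v es → Unique es →
                 ∃ λ es′ → Walk G S u v es′ × Unique es′
      shortcut (there i) j (cons _ _ p)  (_ ∷ uq) = shortcut i j p uq
      shortcut {u = u} {u′} (here refl) j (cons {w = w′} e∈ j′ p) (e∉ ∷ uq) with u ≟ w′
      ... | yes refl = _ , p , uq
      ... | no u≢w′  = _ , cons e∈ (ends j j′) p , e∉ ∷ uq
        where
        ends : ∀ {e c} → Joins G e u u′ → Joins G e c w′ → Joins G e u w′
        ends (inj₁ (refl , refl)) (inj₁ (refl , refl)) = inj₁ (refl , refl)
        ends (inj₁ (refl , refl)) (inj₂ (refl , refl)) = ⊥-elim (u≢w′ refl)
        ends (inj₂ (refl , refl)) (inj₁ (refl , refl)) = ⊥-elim (u≢w′ refl)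
        ends (inj₂ (refl , refl)) (inj₂ (refl , refl)) = inj₂ (refl , refl)

    trail : ∀ {S u v es} → Walk G S u v es → ∃ λ es′ → Walk G S u v es′ × Unique es′
    trail nil = [] , nil , []
    trail (cons {e = e} e∈ j p) with trail p
    ... | es′ , p′ , uq with Any.any? (e ≟_) es′
    ...   | yes i = shortcut i j p′ uq
    ...   | no ¬i = _ , cons e∈ j p′ , All.tabulate (λ { i refl → ¬i i }) ∷ uq

    acyclic⇒noRedundantEdge : ∀ {S} → Acyclic G S → NoRedundantEdge S
    acyclic⇒noRedundantEdge {S} ac e e∈ (_ , p) = let (es , p′ , uq) = trail p in
      ac (tgt e , e ∷ es , cons e∈ (inj₂ (refl , refl)) (up p′) ,
          All.map (λ { f∈ refl → ∉-del f∈ }) (walk-edges p′) ∷ uq , λ ())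
      where
      up : ∀ {u v es} → Walk G (del e S) u v es → Walk G S u v es
      up nil          = nil
      up (cons f j p) = cons (del-⊆ f) j (up p)

    noRedundantEdge⇒acyclic : ∀ {S} → NoRedundantEdge S → Acyclic G S
    noRedundantEdge⇒acyclic {S} nr (_ , [] , nil , _ , ne) = ne refl
    noRedundantEdge⇒acyclic {S} nr (_ , e ∷ es , cons e∈ j p , e∉ ∷ _ , _) = nr e e∈ (orient j (_ , down p e∉))
      where
      down : ∀ {u v es} → Walk G S u v es → All (e ≢_) es → Walk G (del e S) u v es
      down nil          []       = nil
      down (cons f j p) (≢ ∷ ≢s) = cons (∈-del f (≢ ∘ sym)) j (down p ≢s)
      orient : ∀ {u w} → Joins G e u w → Conn G (del e S) w u → Conn G (del e S) (src e) (tgt e)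
      orient (inj₁ (refl , refl)) c = conn-sym c
      orient (inj₂ (refl , refl)) c = c

  -- Spanning forests with prescribed roots

  module Forests {n m : ℕ} (G : Multigraph n m) where
    open Multigraph G
    open Connectivity G

    -- Spanning forests in which every component contains exactly one entry of `Z`: spanning trees
    -- for one root, two-forests separating `a` from `b` for the roots `a` and `b`. A list with a
    -- repeated root admits none, because `separates` would contradict reflexivity; degenerate cases
    -- such as `a = q` thus count as zero.
    record RootedForest (Z : List (Fin n)) (S : Subset m) : Set where
      constructor forest
      field
        covers    : ∀ v → Any (Conn G S v) Z
        separates : AllPairs (λ y z → ¬ Conn G S y z) Z
        minimal   : NoRedundantEdge S
    open RootedForest

    rootedForest? : ∀ Z S → Dec (RootedForest Z S)
    rootedForest? Z S = map′ (λ (c , s , r) → forest c s r) (λ (forest c s r) → c , s , r)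
      (all? (λ v → Any.any? (conn? S v) Z)
       ×-dec AllPairs.allPairs? (λ y z → ¬? (conn? S y z)) Z
       ×-dec all? (λ e → (e ∈? S) →-dec ¬? (conn? (del e S) (src e) (tgt e))))

    conn-ends : ∀ {S e u w} → Joins G e u w → Conn G S (src e) (tgt e) → Conn G S u w
    conn-ends (inj₁ (refl , refl)) c = c
    conn-ends (inj₂ (refl , refl)) c = conn-sym c

    minimal-joins : ∀ {Z S e u w} → RootedForest Z S → e ∈ S → Joins G e u w → ¬ Conn G (del e S) u w
    minimal-joins F e∈ (inj₁ (refl , refl)) c = minimal F _ e∈ c
    minimal-joins F e∈ (inj₂ (refl , refl)) c = minimal F _ e∈ (conn-sym c)

    root-unique : ∀ {Z S y z} → AllPairs (λ y z → ¬ Conn G S y z) Z → y ∈ˡ Z → z ∈ˡ Z → Conn G S y z → y ≡ z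
    root-unique (_ ∷ _)  (here refl) (here refl) c = refl
    root-unique (≁ ∷ _)  (here refl) (there z∈)  c = ⊥-elim (All.lookup ≁ z∈ c)
    root-unique (≁ ∷ _)  (there y∈)  (here refl) c = ⊥-elim (All.lookup ≁ y∈ (conn-sym c))
    root-unique (_ ∷ ap) (there y∈)  (there z∈)  c = root-unique ap y∈ z∈ c

    change-root : ∀ {Z S x y} → Conn G S x y → RootedForest (y ∷ Z) S → RootedForest (x ∷ Z) S
    change-root {Z} {S} {x} {y} x~y (forest c (≁ ∷ ap) r) = forest cov (All.map (λ y≁ x~ → y≁ (conn-trans (conn-sym x~y) x~)) ≁ ∷ ap) r
      where
      cov : ∀ v → Any (Conn G S v) (x ∷ Z)
      cov v with c v
      ... | here v~y = here (conn-trans v~y (conn-sym x~y))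
      ... | there i  = there i

    swap-roots : ∀ {Z S x y} → RootedForest (x ∷ y ∷ Z) S → RootedForest (y ∷ x ∷ Z) S
    swap-roots {Z} {S} {x} {y} (forest c ((x≁y ∷ x≁) ∷ y≁ ∷ ap) r) = forest cov ((x≁y ∘ conn-sym ∷ y≁) ∷ x≁ ∷ ap) r
      where
      cov : ∀ v → Any (Conn G S v) (y ∷ x ∷ Z)
      cov v with c v
      ... | here v~x         = there (here v~x)
      ... | there (here v~y) = here v~y
      ... | there (there i)  = there (there i)

    -- Grafting the tree of a root onto another tree, and the inverse operation

    module Graft {Z : List (Fin n)} {H : Subset m} {x : Fin n} (F : RootedForest (x ∷ Z) H)
                 {g : Fin m} {u : Fin n} (j : Joins G g x u) (u≁x : ¬ Conn G H u x) where

      g∉H : g ∉ H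
      g∉H g∈ = u≁x (conn-edge g∈ (joins-sym j))

      x≁root : ∀ {z} → z ∈ˡ Z → ¬ Conn G H x z
      x≁root z∈ c with separates F
      ... | ≁ ∷ _ = All.lookup ≁ z∈ c

      u~root : ∃ λ z → z ∈ˡ Z × Conn G H u z
      u~root with covers F u
      ... | here u~x = ⊥-elim (u≁x u~x)
      ... | there i  = find i

      K : Subset m
      K = add g H

      x~u : Conn G K x u
      x~u = conn-edge ∈-add j

      split : ∀ {a b} → Conn G K a b → Conn G H a b ⊎ (Conn G H a x × Conn G H u b) ⊎ (Conn G H a u × Conn G H x b)
      split = conn-split ∈-add⁻ j

      graft-conn⁻ : ∀ {z w} → z ∈ˡ Z → Conn G K w z → Conn G H w z ⊎ (Conn G H w x × Conn G H u z)
      graft-conn⁻ z∈ c with split c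
      ... | inj₁ p              = inj₁ p
      ... | inj₂ (inj₁ p)       = inj₂ p
      ... | inj₂ (inj₂ (_ , p)) = ⊥-elim (x≁root z∈ p)

      graft-conn⁺ : ∀ {z w} → Conn G H w z ⊎ (Conn G H w x × Conn G H u z) → Conn G K w z
      graft-conn⁺ (inj₁ p)       = conn-mono ⊆-add p
      graft-conn⁺ (inj₂ (p , q)) = conn-trans (conn-mono ⊆-add p) (conn-trans x~u (conn-mono ⊆-add q))

      graft-root⁻ : ∀ {z} → z ∈ˡ Z → Conn G K x z → Conn G H u z
      graft-root⁻ z∈ c with graft-conn⁻ z∈ c
      ... | inj₁ p       = ⊥-elim (x≁root z∈ p)
      ... | inj₂ (_ , p) = p

      graft : RootedForest Z K
      graft = forest cov (sep Z (λ z∈ → z∈) (AllPairs.tail (separates F))) min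
        where
        cov : ∀ v → Any (Conn G K v) Z
        cov v with covers F v
        ... | here v~x = let (z , z∈ , u~z) = u~root in lose z∈ (graft-conn⁺ (inj₂ (v~x , u~z)))
        ... | there i  = Any.map (conn-mono ⊆-add) i
        sep : ∀ Y → (∀ {z} → z ∈ˡ Y → z ∈ˡ Z) → AllPairs (λ y z → ¬ Conn G H y z) Y → AllPairs (λ y z → ¬ Conn G K y z) Y
        sep []      _   []       = []
        sep (y ∷ Y) Y⊆Z (≁ ∷ ap) = All.tabulate new ∷ sep Y (Y⊆Z ∘ there) ap
          where
          new : ∀ {z} → z ∈ˡ Y → ¬ Conn G K y z
          new z∈ c with graft-conn⁻ (Y⊆Z (there z∈)) c
          ... | inj₁ p       = All.lookup ≁ z∈ p
          ... | inj₂ (p , _) = x≁root (Y⊆Z (here refl)) (conn-sym p)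
        min : NoRedundantEdge K
        min e e∈K c with e ≟ g
        min e e∈K c | yes refl rewrite del-add g∉H = u≁x (conn-sym (conn-ends j c))
        min e e∈K c | no e≢g with ∈-add⁻ e e∈K
        ... | inj₁ e≡g = e≢g e≡g
        ... | inj₂ e∈H with conn-split {H = del e H} K-e⊆ j c
          where
          K-e⊆ : ∀ f → f ∈ del e K → f ≡ g ⊎ f ∈ del e H
          K-e⊆ f f∈ with ∈-add⁻ f (del-⊆ f∈)
          ... | inj₁ f≡g = inj₁ f≡g
          ... | inj₂ f∈H = inj₂ (∈-del f∈H λ { refl → ∉-del f∈ })
        ...   | inj₁ p = minimal F e e∈H p
        -- A detour around `e` that crosses `g` closes up with `e` itself to a connection between
        -- `u` and `x` inside `H`.
        ...   | inj₂ (inj₁ (p , q)) = u≁x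
          (conn-trans (conn-mono del-⊆ q) (conn-trans (conn-sym (conn-edge e∈H (inj₁ (refl , refl)))) (conn-mono del-⊆ p)))
        ...   | inj₂ (inj₂ (p , q)) = u≁x
          (conn-trans (conn-sym (conn-mono del-⊆ p)) (conn-trans (conn-edge e∈H (inj₁ (refl , refl))) (conn-sym (conn-mono del-⊆ q))))

    -- The first edge `g` on the path from `x` to its root, with far end `u`. It is described
    -- through the forest left after its deletion, so that `del g` and `add g` are visibly inverse
    -- to each other.
    ParentEdge : List (Fin n) → Subset m → Fin n → Fin m → Fin n → Set
    ParentEdge Z K x g u = g ∈ K × Joins G g x u × RootedForest (x ∷ Z) (del g K) × ¬ Conn G (del g K) u x

    parentEdge? : ∀ Z K x g u → Dec (ParentEdge Z K x g u)
    parentEdge? Z K x g u = (g ∈? K) ×-dec joins? g x u ×-dec rootedForest? (x ∷ Z) (del g K) ×-dec ¬? (conn? (del g K) u x)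

    parentEdge⇒forest : ∀ {Z K x g u} → ParentEdge Z K x g u → RootedForest Z K
    parentEdge⇒forest {Z} (g∈ , j , F , u≁x) = subst (RootedForest Z) (add-del g∈) (Graft.graft F j u≁x)

    -- After deletion of `g`, the vertex `u` still reaches a root `z`. If it does so without `g′`,
    -- then `x` reaches `z` through `g` in `del g′ K`, where `x` is itself a separate root. If it
    -- needs `g′`, it passes through `x`, although in `del g K` the vertex `x` is apart from both
    -- `u` and `z`.
    parentEdge-unique : ∀ {Z K x g u g′ u′} → ParentEdge Z K x g u → ParentEdge Z K x g′ u′ → g ≡ g′
    parentEdge-unique {Z} {K} {x} {g} {u} {g′} {u′} (g∈ , j , F , u≁x) (g′∈ , j′ , F′ , u′≁x) with g ≟ g′
    ... | yes g≡g′ = g≡g′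
    ... | no g≢g′  = ⊥-elim (case conn-split {H = del g′ (del g K)} ∈-del-or-≡ j′ u~z of λ where
        (inj₁ p)              → Graft.x≁root F′ j′ u′≁x z∈
          (conn-trans (conn-edge (∈-del g∈ g≢g′) j) (conn-mono (λ e∈ → ∈-del (del-⊆ (del-⊆ e∈)) λ { refl → ∉-del e∈ }) p))
        (inj₂ (inj₁ (p , _))) → u≁x (conn-mono del-⊆ p)
        (inj₂ (inj₂ (_ , p))) → Graft.x≁root F j u≁x z∈ (conn-mono del-⊆ p))
      where
      root = Graft.u~root F j u≁x
      z∈ = proj₁ (proj₂ root)
      u~z = proj₂ (proj₂ root)

    private
      LeavesAt : Subset m → Fin n → Fin n → Set
      LeavesAt K x z = ∃₂ λ g u → g ∈ K × Joins G g x u × Conn G (del g K) u z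

      Avoids : Subset m → Fin n → Fin n → Fin n → Set
      Avoids K x w z = w ≢ x × (∀ g u → Joins G g x u → Conn G (del g K) w z)

      -- Read the walk backwards from `z`. Before it meets `x`, none of its edges is incident with
      -- `x`, so that part survives the deletion of any edge at `x`; in particular of the edge by
      -- which the walk last leaves `x`.
      last-exit : ∀ {K x w z es} → z ≢ x → Walk G K w z es → Avoids K x w z ⊎ LeavesAt K x z
      last-exit z≢x nil = inj₁ (z≢x , λ _ _ _ → conn-refl)
      last-exit {K} {x} {w} z≢x (cons {w = w′} {e = e} e∈ j p) with last-exit z≢x p
      ... | inj₂ l = inj₂ l
      ... | inj₁ (w′≢x , av) with w ≟ x
      ...   | yes refl = inj₂ (e , w′ , e∈ , j , av e w′ j)
      ...   | no w≢x   = inj₁ (w≢x , λ g u jg → conn-trans (conn-edge (∈-del e∈ λ { refl → absurd jg j }) j) (av g u jg))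
        where
        absurd : ∀ {e u} → Joins G e x u → ¬ Joins G e w w′
        absurd (inj₁ (refl , refl)) (inj₁ (refl , refl)) = w≢x refl
        absurd (inj₁ (refl , refl)) (inj₂ (refl , refl)) = w′≢x refl
        absurd (inj₂ (refl , refl)) (inj₁ (refl , refl)) = w′≢x refl
        absurd (inj₂ (refl , refl)) (inj₂ (refl , refl)) = w≢x refl

    -- The edge by which a walk from `x` to its root last leaves `x` qualifies: the rest of the walk
    -- avoids it, so its far end keeps the root, while minimality cuts `x` off from that end and
    -- makes `x` the root of what is split off.
    parentEdge-exists : ∀ {Z K x} → x ∉ˡ Z → RootedForest Z K → ∃₂ λ g u → ParentEdge Z K x g u
    parentEdge-exists {Z} {K} {x} x∉ F with find (covers F x)
    ... | z , z∈ , (_ , x~z) with last-exit (λ { refl → x∉ z∈ }) x~z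
    ...   | inj₁ (x≢x , _) = ⊥-elim (x≢x refl)
    ...   | inj₂ (g , u , g∈ , j , u~z) = g , u , g∈ , j , forest cov (All.tabulate x≁ ∷ AllPairs.map (_∘ up) (separates F)) min , u≁x
      where
      K⁻ = del g K
      up : ∀ {a b} → Conn G K⁻ a b → Conn G K a b
      up = conn-mono del-⊆
      u≁x : ¬ Conn G K⁻ u x
      u≁x = minimal-joins F g∈ (joins-sym j)
      cov : ∀ v → Any (Conn G K⁻ v) (x ∷ Z)
      cov v with find (covers F v)
      ... | z′ , z′∈ , v~z′ with conn-split ∈-del-or-≡ j v~z′
      ...   | inj₁ p              = there (lose z′∈ p)
      ...   | inj₂ (inj₁ (p , _)) = here p
      ...   | inj₂ (inj₂ (p , _)) = there (lose z∈ (conn-trans p u~z))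
      x≁ : ∀ {z′} → z′ ∈ˡ Z → ¬ Conn G K⁻ x z′
      x≁ z′∈ c with root-unique (separates F) z∈ z′∈ (conn-trans (conn-sym (up u~z)) (conn-trans (conn-sym (conn-edge g∈ j)) (up c)))
      ... | refl = u≁x (conn-trans u~z (conn-sym c))
      min : NoRedundantEdge K⁻
      min e e∈ c = minimal F e (del-⊆ e∈) (conn-mono (λ f∈ → ∈-del (del-⊆ (del-⊆ f∈)) λ { refl → ∉-del f∈ }) c)

    -- Two-forests

    separated⇒rooted : ∀ {S a b} → IsTwoForest G S → ¬ Conn G S a b → RootedForest (a ∷ b ∷ []) S
    separated⇒rooted {S} {a} {b} (ac , c , d , c≁d , cov) a≁b = forest cov′ ((a≁b ∷ []) ∷ [] ∷ []) (acyclic⇒noRedundantEdge ac)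
      where
      cov′ : ∀ v → Any (Conn G S v) (a ∷ b ∷ [])
      cov′ v with cov a | cov b | cov v
      ... | inj₁ p | inj₁ q | _      = ⊥-elim (a≁b (conn-trans (conn-sym p) q))
      ... | inj₂ p | inj₂ q | _      = ⊥-elim (a≁b (conn-trans (conn-sym p) q))
      ... | inj₁ p | inj₂ q | inj₁ r = here (conn-trans (conn-sym r) p)
      ... | inj₁ p | inj₂ q | inj₂ r = there (here (conn-trans (conn-sym r) q))
      ... | inj₂ p | inj₁ q | inj₁ r = there (here (conn-trans (conn-sym r) q))
      ... | inj₂ p | inj₁ q | inj₂ r = here (conn-trans (conn-sym r) p)

    rooted⇒twoForest : ∀ {S a b} → RootedForest (a ∷ b ∷ []) S → IsTwoForest G S
    rooted⇒twoForest {S} {a} {b} (forest c ((a≁b ∷ []) ∷ _) r) = noRedundantEdge⇒acyclic r , a , b , a≁b , cov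
      where
      cov : ∀ v → Conn G S a v ⊎ Conn G S b v
      cov v with c v
      ... | here p         = inj₁ (conn-sym p)
      ... | there (here p) = inj₂ (conn-sym p)

    rooted⇒separated : ∀ {S a b} → RootedForest (a ∷ b ∷ []) S → ¬ Conn G S a b
    rooted⇒separated (forest _ ((a≁b ∷ []) ∷ _) _) = a≁b

    isTwoForest? : ∀ S → Dec (IsTwoForest G S)
    isTwoForest? S = map′ (λ (_ , _ , F) → rooted⇒twoForest F) (λ F@(_ , a , b , a≁b , _) → a , b , separated⇒rooted F a≁b)
      (any? λ a → any? λ b → rootedForest? (a ∷ b ∷ []) S)

  -- Reindexing sums, and summing over all edge sets

  module _ {A B : Set} (_≟A_ : DecidableEquality A) (_≟B_ : DecidableEquality B)
           {xs : List A} (xs! : Unique xs) (xs∋ : ∀ a → a ∈ˡ xs)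
           {ys : List B} (ys! : Unique ys) (ys∋ : ∀ b → b ∈ˡ ys) where

    -- The maps `f` and `h` are inverse only between the parts cut out by `P` and `Q`, as `del g`
    -- and `add g` are. On these parts the deltas of `b = f a` and `a = h b` agree, which allows one
    -- to be exchanged for the other after swapping the sums.
    ∑-reindex : {P : A → Set} {Q : B → Set} (P? : ∀ a → Dec (P a)) (Q? : ∀ b → Dec (Q b)) (f : A → B) (h : B → A) →
                (∀ {a} → P a → Q (f a) × h (f a) ≡ a) → (∀ {b} → Q b → P (h b) × f (h b) ≡ b) → (φ : A → ℤ) →
                ∑ xs (λ a → 𝟙 (P? a) * φ a) ≡ ∑ ys (λ b → 𝟙 (Q? b) * φ (h b))
    ∑-reindex {P} {Q} P? Q? f h P⇒Q Q⇒P φ = begin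
      ∑ xs (λ a → 𝟙 (P? a) * φ a)
        ≡⟨ ∑-cong xs (λ a → ∑-δ _≟B_ ys ys! (λ _ → 𝟙 (P? a) * φ a) (ys∋ (f a))) ⟨
      ∑ xs (λ a → ∑ ys (λ b → 𝟙 (b ≟B f a) * (𝟙 (P? a) * φ a)))
        ≡⟨ ∑-swap xs ys _ ⟩
      ∑ ys (λ b → ∑ xs (λ a → 𝟙 (b ≟B f a) * (𝟙 (P? a) * φ a)))
        ≡⟨ ∑-cong ys (λ b → ∑-cong xs (λ a → exchange a b)) ⟩
      ∑ ys (λ b → ∑ xs (λ a → 𝟙 (a ≟A h b) * (𝟙 (Q? b) * φ a)))
        ≡⟨ ∑-cong ys (λ b → ∑-δ _≟A_ xs xs! (λ a → 𝟙 (Q? b) * φ a) (xs∋ (h b))) ⟩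
      ∑ ys (λ b → 𝟙 (Q? b) * φ (h b)) ∎
      where
      open ≡-Reasoning
      exchange : ∀ a b → 𝟙 (b ≟B f a) * (𝟙 (P? a) * φ a) ≡ 𝟙 (a ≟A h b) * (𝟙 (Q? b) * φ a)
      exchange a b = begin
        𝟙 (b ≟B f a) * (𝟙 (P? a) * φ a) ≡⟨ *-assoc (𝟙 (b ≟B f a)) _ _ ⟨
        𝟙 (b ≟B f a) * 𝟙 (P? a) * φ a   ≡⟨ cong (_* φ a) (𝟙-× (b ≟B f a) (P? a) ((a ≟A h b) ×-dec Q? b)
                                             (λ { (refl , q) → let (p , eq) = Q⇒P q in sym eq , p })
                                             (λ { refl p → let (q , eq) = P⇒Q p in sym eq , q })) ⟩
        𝟙 ((a ≟A h b) ×-dec Q? b) * φ a ≡⟨ cong (_* φ a) (𝟙-× (a ≟A h b) (Q? b) ((a ≟A h b) ×-dec Q? b) (λ z → z) _,_) ⟨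
        𝟙 (a ≟A h b) * 𝟙 (Q? b) * φ a   ≡⟨ *-assoc (𝟙 (a ≟A h b)) _ _ ⟩
        𝟙 (a ≟A h b) * (𝟙 (Q? b) * φ a) ∎

  subsets : ∀ m → List (Subset m)
  subsets zero    = [] ∷ []
  subsets (suc m) = cartesianProductWith _∷_ (true ∷ false ∷ []) (subsets m)

  subsets! : ∀ m → Unique (subsets m)
  subsets! zero    = [] ∷ []
  subsets! (suc m) = cartesianProductWith⁺ _∷_ ∷-injective (((λ ()) ∷ []) ∷ [] ∷ []) (subsets! m)

  ∈-subsets : ∀ {m} (S : Subset m) → S ∈ˡ subsets m
  ∈-subsets []          = here refl
  ∈-subsets (true ∷ S)  = ∈-cartesianProductWith⁺ _∷_ {xs = true ∷ false ∷ []} (here refl) (∈-subsets S)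
  ∈-subsets (false ∷ S) = ∈-cartesianProductWith⁺ _∷_ {xs = true ∷ false ∷ []} (there (here refl)) (∈-subsets S)

  _≟ˢ_ : ∀ {m} → DecidableEquality (Subset m)
  _≟ˢ_ = ≡-dec Bool._≟_

  ∑-antisym : {A : Set} (xs : List A) (f : A → A → ℤ) → ∑ xs (λ x → ∑ xs (λ y → f x y - f y x)) ≡ 0ℤ
  ∑-antisym xs f = begin
    ∑ xs (λ x → ∑ xs (λ y → f x y - f y x))
      ≡⟨ ∑-cong xs (λ x → ∑-- xs (f x) _) ⟩
    ∑ xs (λ x → ∑ xs (f x) - ∑ xs (λ y → f y x))
      ≡⟨ ∑-- xs _ _ ⟩
    ∑ xs (λ x → ∑ xs (f x)) - ∑ xs (λ x → ∑ xs (λ y → f y x))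
      ≡⟨ cong (_- ∑ xs (λ x → ∑ xs (λ y → f y x))) (∑-swap xs xs f) ⟩
    ∑ xs (λ x → ∑ xs (λ y → f y x)) - ∑ xs (λ x → ∑ xs (λ y → f y x))
      ≡⟨ +-inverseʳ (∑ xs (λ x → ∑ xs (λ y → f y x))) ⟩
    0ℤ ∎
    where open ≡-Reasoning

  𝟙-¬ : {P : Set} (d : Dec P) → 𝟙 (¬? d) ≡ 1ℤ - 𝟙 d
  𝟙-¬ (yes _) = refl
  𝟙-¬ (no _)  = refl

  -- Forest counts as the Green function of the Laplacian

  module Counting {n m : ℕ} (G : Multigraph n m) where
    open Multigraph G
    open Connectivity G
    open Forests G
    open ≡-Reasoning

    V : List (Fin n)
    V = allFin n

    E : List (Fin m)
    E = allFin m

    𝒫 : List (Subset m)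
    𝒫 = subsets m

    forestCount : List (Fin n) → ℤ
    forestCount Z = ∑ 𝒫 (λ S → 𝟙 (rootedForest? Z S))

    ∑-parentEdge : ∀ {Z x} → x ∉ˡ Z → ∀ K →
      ∑ E (λ g → ∑ V (λ u → 𝟙 (parentEdge? Z K x g u))) ≡ 𝟙 (rootedForest? Z K)
    ∑-parentEdge {Z} {x} x∉ K = begin
      ∑ E (λ g → ∑ V (λ u → 𝟙 (parentEdge? Z K x g u)))
        ≡⟨ ∑-cong E (λ g → ∑-exactlyOne (parentEdge? Z K x g) (any? (parentEdge? Z K x g)) V (allFin⁺ n) (_ ,_)
             (λ (_ , j , _) (_ , j′ , _) → joins-unique j j′) (λ (u , p) → u , ∈-allFin u , p)) ⟩
      ∑ E (λ g → 𝟙 (any? (parentEdge? Z K x g)))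
        ≡⟨ ∑-exactlyOne (λ g → any? (parentEdge? Z K x g)) (rootedForest? Z K) E (allFin⁺ m)
             (λ (_ , p) → parentEdge⇒forest p) (λ (_ , p) (_ , q) → parentEdge-unique p q)
             (λ F → let (g , u , p) = parentEdge-exists x∉ F in g , ∈-allFin g , u , p) ⟩
      𝟙 (rootedForest? Z K) ∎

    -- Each K on the left is cut uniquely at the first edge from x towards its root.
    ∑-peel : ∀ {Z x} → x ∉ˡ Z → (φ : Subset m → ℤ) →
      ∑ 𝒫 (λ K → 𝟙 (rootedForest? Z K) * φ K) ≡
      ∑ 𝒫 (λ H → 𝟙 (rootedForest? (x ∷ Z) H) *
        ∑ E (λ g → ∑ V (λ u → 𝟙 (joins? g x u) * (𝟙 (¬? (conn? H u x)) * φ (add g H)))))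
    ∑-peel {Z} {x} x∉ φ = begin
      ∑ 𝒫 (λ K → 𝟙 (rootedForest? Z K) * φ K)
        ≡⟨ ∑-cong 𝒫 (λ K → cong (_* φ K) (∑-parentEdge x∉ K)) ⟨
      ∑ 𝒫 (λ K → ∑ E (λ g → ∑ V (λ u → 𝟙 (parentEdge? Z K x g u))) * φ K)
        ≡⟨ ∑-cong 𝒫 (λ K → trans (sym (∑-*ʳ E (φ K) _)) (∑-cong E (λ g → sym (∑-*ʳ V (φ K) _)))) ⟩
      ∑ 𝒫 (λ K → ∑ E (λ g → ∑ V (λ u → 𝟙 (parentEdge? Z K x g u) * φ K)))
        ≡⟨ ∑-swap 𝒫 E _ ⟩
      ∑ E (λ g → ∑ 𝒫 (λ K → ∑ V (λ u → 𝟙 (parentEdge? Z K x g u) * φ K)))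
        ≡⟨ ∑-cong E (λ g → ∑-swap 𝒫 V _) ⟩
      ∑ E (λ g → ∑ V (λ u → ∑ 𝒫 (λ K → 𝟙 (parentEdge? Z K x g u) * φ K)))
        ≡⟨ ∑-cong E (λ g → ∑-cong V (λ u → regraft g u)) ⟩
      ∑ E (λ g → ∑ V (λ u → ∑ 𝒫 (λ H → 𝟙 (rootedForest? (x ∷ Z) H) * term H g u)))
        ≡⟨ ∑-cong E (λ g → ∑-swap 𝒫 V _) ⟨
      ∑ E (λ g → ∑ 𝒫 (λ H → ∑ V (λ u → 𝟙 (rootedForest? (x ∷ Z) H) * term H g u)))
        ≡⟨ ∑-swap 𝒫 E _ ⟨
      ∑ 𝒫 (λ H → ∑ E (λ g → ∑ V (λ u → 𝟙 (rootedForest? (x ∷ Z) H) * term H g u)))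
        ≡⟨ ∑-cong 𝒫 (λ H → trans (∑-cong E (λ g → ∑-*ˡ V (𝟙 (rootedForest? (x ∷ Z) H)) (term H g)))
             (∑-*ˡ E (𝟙 (rootedForest? (x ∷ Z) H)) (λ g → ∑ V (term H g)))) ⟩
      ∑ 𝒫 (λ H → 𝟙 (rootedForest? (x ∷ Z) H) * ∑ E (λ g → ∑ V (λ u → term H g u))) ∎
      where
      term : Subset m → Fin m → Fin n → ℤ
      term H g u = 𝟙 (joins? g x u) * (𝟙 (¬? (conn? H u x)) * φ (add g H))

      regraft : ∀ g u → ∑ 𝒫 (λ K → 𝟙 (parentEdge? Z K x g u) * φ K) ≡
                        ∑ 𝒫 (λ H → 𝟙 (rootedForest? (x ∷ Z) H) * term H g u)
      regraft g u = begin
        ∑ 𝒫 (λ K → 𝟙 (parentEdge? Z K x g u) * φ K)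
          ≡⟨ ∑-reindex _≟ˢ_ _≟ˢ_ (subsets! m) ∈-subsets (subsets! m) ∈-subsets
               (λ K → parentEdge? Z K x g u) graftable? (del g) (add g)
               (λ (g∈ , j , F , u≁x) → (F , j , u≁x) , add-del g∈)
               (λ (F , j , u≁x) → let eq = del-add (Graft.g∉H F j u≁x) in
                  (∈-add , j , subst (RootedForest (x ∷ Z)) (sym eq) F , subst (λ S → ¬ Conn G S u x) (sym eq) u≁x) , eq)
               φ ⟩
        ∑ 𝒫 (λ H → 𝟙 (graftable? H) * φ (add g H))
          ≡⟨ ∑-cong 𝒫 (λ H → trans
               (cong (_* φ (add g H)) (sym (trans (cong (𝟙 (rootedForest? (x ∷ Z) H) *_)
                  (𝟙-× (joins? g x u) (¬? (conn? H u x)) (joins? g x u ×-dec ¬? (conn? H u x)) (λ z → z) _,_))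
                  (𝟙-× (rootedForest? (x ∷ Z) H) (joins? g x u ×-dec ¬? (conn? H u x)) (graftable? H) (λ z → z) _,_))))
               (assoc₄ (𝟙 (rootedForest? (x ∷ Z) H)) (𝟙 (joins? g x u)) (𝟙 (¬? (conn? H u x))) (φ (add g H)))) ⟩
        ∑ 𝒫 (λ H → 𝟙 (rootedForest? (x ∷ Z) H) * term H g u) ∎
        where
        graftable? : ∀ H → Dec (RootedForest (x ∷ Z) H × Joins G g x u × ¬ Conn G H u x)
        graftable? H = rootedForest? (x ∷ Z) H ×-dec joins? g x u ×-dec ¬? (conn? H u x)
        assoc₄ : ∀ a b c d → a * (b * c) * d ≡ a * (b * (c * d))
        assoc₄ = solve-∀

    mult : Fin n → Fin n → ℤ
    mult x u = ∑ E (λ g → 𝟙 (joins? g x u))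

    ∑-joins : ∀ x (k : Fin n → ℤ) → ∑ E (λ g → ∑ V (λ u → 𝟙 (joins? g x u) * k u)) ≡ ∑ V (λ u → mult x u * k u)
    ∑-joins x k = trans (∑-swap E V _) (∑-cong V (λ u → ∑-*ʳ E (k u) _))

    laplacian : (Fin n → ℤ) → Fin n → ℤ
    laplacian f x = ∑ V (λ u → mult x u * (f x - f u))

    -- This is `forestCount Z` times the Green function with pole `y` and zero boundary values on
    -- `Z`. A general `Z` is kept because the count of three-forests uses two boundary vertices.
    green : List (Fin n) → Fin n → Fin n → ℤ
    green Z y x = ∑ 𝒫 (λ H → 𝟙 (rootedForest? (y ∷ Z) H) * 𝟙 (conn? H x y))

    private
      drop : Fin n → Fin n → Subset m → ℤ
      drop x y H = ∑ V (λ u → mult x u * (𝟙 (conn? H x y) - 𝟙 (conn? H u y)))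

      laplacian-drop : ∀ Z y x → laplacian (green Z y) x ≡ ∑ 𝒫 (λ H → 𝟙 (rootedForest? (y ∷ Z) H) * drop x y H)
      laplacian-drop Z y x = begin
        ∑ V (λ u → mult x u * (green Z y x - green Z y u))
          ≡⟨ ∑-cong V (λ u → trans (cong (mult x u *_) (sym (∑-- 𝒫 _ _))) (sym (∑-*ˡ 𝒫 (mult x u) _))) ⟩
        ∑ V (λ u → ∑ 𝒫 (λ H → mult x u * (F H * C H x - F H * C H u)))
          ≡⟨ ∑-swap V 𝒫 _ ⟩
        ∑ 𝒫 (λ H → ∑ V (λ u → mult x u * (F H * C H x - F H * C H u)))
          ≡⟨ ∑-cong 𝒫 (λ H → trans (∑-cong V (λ u → factor (mult x u) (F H) (C H x) (C H u)))
             (∑-*ˡ V (F H) (λ u → mult x u * (C H x - C H u)))) ⟩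
        ∑ 𝒫 (λ H → F H * drop x y H) ∎
        where
        F : Subset m → ℤ
        F H = 𝟙 (rootedForest? (y ∷ Z) H)
        C : Subset m → Fin n → ℤ
        C H u = 𝟙 (conn? H u y)
        factor : ∀ c f a b → c * (f * a - f * b) ≡ f * (c * (a - b))
        factor = solve-∀

    -- For a forest `H` rooted at `x ∷ Z`, `drop x x H` is the number of edges at `x` that leave its
    -- component. These are exactly the edges along which `x` can be grafted, so `∑-peel` with
    -- weight one turns the sum into the forests rooted at `Z`.
    laplacian-green-pole : ∀ {Z x} → x ∉ˡ Z → laplacian (green Z x) x ≡ forestCount Z
    laplacian-green-pole {Z} {x} x∉ = begin
      laplacian (green Z x) x
        ≡⟨ laplacian-drop Z x x ⟩
      ∑ 𝒫 (λ H → 𝟙 (rootedForest? (x ∷ Z) H) * drop x x H)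
        ≡⟨ ∑-cong 𝒫 (λ H → cong (𝟙 (rootedForest? (x ∷ Z) H) *_) (sym (trans (∑-joins x _) (∑-cong V (λ u →
             cong (mult x u *_) (trans (*-identityʳ _)
               (trans (𝟙-¬ (conn? H u x)) (cong (_- 𝟙 (conn? H u x)) (sym (𝟙-yes (conn? H x x) conn-refl))))))))) ) ⟩
      ∑ 𝒫 (λ H → 𝟙 (rootedForest? (x ∷ Z) H) *
        ∑ E (λ g → ∑ V (λ u → 𝟙 (joins? g x u) * (𝟙 (¬? (conn? H u x)) * 1ℤ))))
        ≡⟨ ∑-peel x∉ (λ _ → 1ℤ) ⟨
      ∑ 𝒫 (λ K → 𝟙 (rootedForest? Z K) * 1ℤ)
        ≡⟨ ∑-cong 𝒫 (λ K → *-identityʳ _) ⟩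
      forestCount Z ∎

    -- Peeling at `x` leaves forests rooted at `x ∷ y ∷ Z` together with two neighbours of `x`: `u`,
    -- to which `x` was attached, and `w`, at which the Laplacian takes its difference. Exchanging
    -- `u` and `w` cancels the sum.
    laplacian-green-harmonic : ∀ {Z x y} → x ∉ˡ Z → x ≢ y → laplacian (green Z y) x ≡ 0ℤ
    laplacian-green-harmonic {Z} {x} {y} x∉ x≢y = begin
      laplacian (green Z y) x
        ≡⟨ laplacian-drop Z y x ⟩
      ∑ 𝒫 (λ K → 𝟙 (rootedForest? (y ∷ Z) K) * drop x y K)
        ≡⟨ ∑-peel (λ { (here x≡y) → x≢y x≡y ; (there x∈) → x∉ x∈ }) (drop x y) ⟩
      ∑ 𝒫 (λ H → 𝟙 (rootedForest? (x ∷ y ∷ Z) H) *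
        ∑ E (λ g → ∑ V (λ u → 𝟙 (joins? g x u) * (𝟙 (¬? (conn? H u x)) * drop x y (add g H)))))
        ≡⟨ ∑-cong 𝒫 (λ H → trans (𝟙-guard (rootedForest? (x ∷ y ∷ Z) H) (balance H)) (*-zeroʳ (𝟙 (rootedForest? (x ∷ y ∷ Z) H)))) ⟩
      ∑ 𝒫 (λ _ → 0ℤ)
        ≡⟨ ∑-zero 𝒫 ⟩
      0ℤ ∎
      where
      -- α and ξ mark the components of y and x in H, and β = 1 − ξ.  Grafting x along an edge to u and then moving along an edge to w
      -- changes the indicator of y's component by β w α u − α w, which is antisymmetric in u and w once weighted by β u.
      balance : ∀ H → RootedForest (x ∷ y ∷ Z) H →
        ∑ E (λ g → ∑ V (λ u → 𝟙 (joins? g x u) * (𝟙 (¬? (conn? H u x)) * drop x y (add g H)))) ≡ 0ℤ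
      balance H F = begin
        ∑ E (λ g → ∑ V (λ u → 𝟙 (joins? g x u) * (𝟙 (¬? (conn? H u x)) * drop x y (add g H))))
          ≡⟨ ∑-cong E (λ g → ∑-cong V (λ u → 𝟙-guard (joins? g x u) (λ j → 𝟙-guard (¬? (conn? H u x)) (drop-graft j)))) ⟩
        ∑ E (λ g → ∑ V (λ u → 𝟙 (joins? g x u) * (𝟙 (¬? (conn? H u x)) * ∑ V (λ w → c w * (α u - (α w + ξ w * α u))))))
          ≡⟨ ∑-joins x _ ⟩
        ∑ V (λ u → c u * (𝟙 (¬? (conn? H u x)) * ∑ V (λ w → c w * (α u - (α w + ξ w * α u)))))
          ≡⟨ ∑-cong V (λ u → cong (c u *_) (sym (∑-*ˡ V (𝟙 (¬? (conn? H u x))) (λ w → c w * (α u - (α w + ξ w * α u)))))) ⟩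
        ∑ V (λ u → c u * ∑ V (λ w → 𝟙 (¬? (conn? H u x)) * (c w * (α u - (α w + ξ w * α u)))))
          ≡⟨ ∑-cong V (λ u → sym (∑-*ˡ V (c u) _)) ⟩
        ∑ V (λ u → ∑ V (λ w → c u * (𝟙 (¬? (conn? H u x)) * (c w * (α u - (α w + ξ w * α u))))))
          ≡⟨ ∑-cong V (λ u → ∑-cong V (λ w → antisymmetric u w)) ⟩
        ∑ V (λ u → ∑ V (λ w → c u * c w * ((1ℤ - ξ w) * α u) - c w * c u * ((1ℤ - ξ u) * α w)))
          ≡⟨ ∑-antisym V (λ u w → c u * c w * ((1ℤ - ξ w) * α u)) ⟩
        0ℤ ∎
        where
        c α ξ : Fin n → ℤ
        c = mult x
        α w = 𝟙 (conn? H w y)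
        ξ w = 𝟙 (conn? H w x)

        x≁y : ¬ Conn G H x y
        x≁y p with RootedForest.separates F
        ... | (≁ ∷ _) ∷ _ = ≁ p

        α-ξ-disjoint : ∀ w → ξ w * α w ≡ 0ℤ
        α-ξ-disjoint w = 𝟙-× (conn? H w x) (conn? H w y) (no (λ z → z)) (λ ()) (λ p q → x≁y (conn-trans (conn-sym p) q))

        antisymmetric : ∀ u w → c u * (𝟙 (¬? (conn? H u x)) * (c w * (α u - (α w + ξ w * α u)))) ≡
                                c u * c w * ((1ℤ - ξ w) * α u) - c w * c u * ((1ℤ - ξ u) * α w)
        antisymmetric u w = begin
          c u * (𝟙 (¬? (conn? H u x)) * (c w * (α u - (α w + ξ w * α u))))
            ≡⟨ cong (λ b → c u * (b * (c w * (α u - (α w + ξ w * α u))))) (𝟙-¬ (conn? H u x)) ⟩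
          c u * ((1ℤ - ξ u) * (c w * (α u - (α w + ξ w * α u))))
            ≡⟨ expand (c u) (c w) (ξ u) (ξ w) (α u) (α w) ⟩
          c u * c w * ((1ℤ - ξ w) * α u) - c w * c u * ((1ℤ - ξ u) * α w) - c u * c w * (1ℤ - ξ w) * (ξ u * α u)
            -- The one term without an antisymmetric partner would need `u` to lie in the components
            -- of both `x` and `y`.
            ≡⟨ cong (λ k → rest - c u * c w * (1ℤ - ξ w) * k) (α-ξ-disjoint u) ⟩
          rest - c u * c w * (1ℤ - ξ w) * 0ℤ
            ≡⟨ simp rest (c u * c w * (1ℤ - ξ w)) ⟩
          rest ∎
          where
          rest = c u * c w * ((1ℤ - ξ w) * α u) - c w * c u * ((1ℤ - ξ u) * α w)
          expand : ∀ cu cw ξu ξw αu αw → cu * ((1ℤ - ξu) * (cw * (αu - (αw + ξw * αu)))) ≡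
            cu * cw * ((1ℤ - ξw) * αu) - cw * cu * ((1ℤ - ξu) * αw) - cu * cw * (1ℤ - ξw) * (ξu * αu)
          expand = solve-∀
          simp : ∀ r k → r - k * 0ℤ ≡ r
          simp = solve-∀

        drop-graft : ∀ {g u} → Joins G g x u → ¬ Conn G H u x →
          drop x y (add g H) ≡ ∑ V (λ w → c w * (α u - (α w + ξ w * α u)))
        drop-graft {g} {u} j u≁x = ∑-cong V λ w → cong (c w *_) (cong₂ _-_
          (𝟙-cong (conn? (add g H) x y) (conn? H u y) (graft-root⁻ y∈) (λ p → graft-conn⁺ (inj₂ (conn-refl , p))))
          (via w))
          where
          open Graft F j u≁x
          y∈ : y ∈ˡ y ∷ Z
          y∈ = here refl
          via : ∀ w → 𝟙 (conn? (add g H) w y) ≡ α w + ξ w * α u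
          via w with conn? H w y
          ... | yes w~y = trans (𝟙-yes (conn? (add g H) w y) (graft-conn⁺ (inj₁ w~y)))
                  (sym (trans (cong (λ k → 1ℤ + k * α u) (𝟙-no (conn? H w x) (λ w~x → x≁y (conn-trans (conn-sym w~x) w~y)))) refl))
          ... | no w≁y  = trans (sym (𝟙-× (conn? H w x) (conn? H u y) (conn? (add g H) w y)
                  (λ p → [ (λ q → ⊥-elim (w≁y q)) , (λ q → q) ]′ (graft-conn⁻ y∈ p)) (λ p q → graft-conn⁺ (inj₂ (p , q)))))
                  (sym (ℤ.+-identityˡ _))

  -- Sums over enumerations, and the Cauchy-Schwarz inequality

  module _ {A : Set} (_≟A_ : DecidableEquality A) {ys : List A} (ys! : Unique ys) (ys∋ : ∀ a → a ∈ˡ ys) where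

    ∑-enumerates : {P : A → Set} (P? : ∀ a → Dec (P a)) {xs : List A} → Enumerates P xs → (f : A → ℤ) →
                   ∑ xs f ≡ ∑ ys (λ y → 𝟙 (P? y) * f y)
    ∑-enumerates P? {xs} (xs! , xs⇔) f = begin
      ∑ xs f
        ≡⟨ ∑-cong xs (λ x → ∑-δ _≟A_ ys ys! f (ys∋ x)) ⟨
      ∑ xs (λ x → ∑ ys (λ y → 𝟙 (y ≟A x) * f y))
        ≡⟨ ∑-swap xs ys _ ⟩
      ∑ ys (λ y → ∑ xs (λ x → 𝟙 (y ≟A x) * f y))
        ≡⟨ ∑-cong ys (λ y → trans (∑-*ʳ xs (f y) (λ x → 𝟙 (y ≟A x))) (cong (_* f y)
             (∑-exactlyOneIn y))) ⟩
      ∑ ys (λ y → 𝟙 (P? y) * f y) ∎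
      where
      open ≡-Reasoning
      ∑-exactlyOneIn : ∀ y → ∑ xs (λ x → 𝟙 (y ≟A x)) ≡ 𝟙 (P? y)
      ∑-exactlyOneIn y with Any.any? (y ≟A_) xs
      ... | yes y∈ = ∑-exactlyOne (y ≟A_) (P? y) xs xs! (λ _ → Equivalence.to (xs⇔ y) y∈) (λ p r → trans (sym p) r) (λ _ → y , y∈ , refl)
      ... | no y∉  = trans (∑-none (y ≟A_) xs (All.tabulate (λ { x∈ refl → y∉ x∈ })))
                           (sym (𝟙-no (P? y) (λ p → y∉ (Equivalence.from (xs⇔ y) p))))

  ∑-one : {A : Set} (xs : List A) → ∑ xs (λ _ → 1ℤ) ≡ pos (length xs)
  ∑-one []       = refl
  ∑-one (x ∷ xs) = cong (1ℤ +_) (∑-one xs)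

  ∑-sum : {A : Set} (xs : List A) (f : A → ℕ) → pos (sum (map f xs)) ≡ ∑ xs (λ x → pos (f x))
  ∑-sum []       f = refl
  ∑-sum (x ∷ xs) f = cong (pos (f x) +_) (∑-sum xs f)

  ∑-cong-∈ : {A : Set} (xs : List A) {f g : A → ℤ} → (∀ x → x ∈ˡ xs → f x ≡ g x) → ∑ xs f ≡ ∑ xs g
  ∑-cong-∈ []       eq = refl
  ∑-cong-∈ (x ∷ xs) eq = cong₂ _+_ (eq x (here refl)) (∑-cong-∈ xs (λ y y∈ → eq y (there y∈)))

  square-nonneg : ∀ i → 0ℤ ≤ i * i
  square-nonneg (pos k)         = subst (0ℤ ≤_) (ℤ.pos-* k k) (+≤+ z≤n)
  square-nonneg -[1+ k ] = +≤+ z≤n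

  i≡j+k⇒j≤i : ∀ {i j k} → i ≡ j + k → 0ℤ ≤ k → j ≤ i
  i≡j+k⇒j≤i {j = j} eq k≥0 = subst₂ _≤_ (ℤ.+-identityʳ j) (sym eq) (ℤ.+-monoʳ-≤ j k≥0)

  -- Induction on the list. The new cross terms are bounded by 2ab ≤ a² + b², summed over the tail
  -- with slack Σ (t x - t y)².
  cauchy-schwarz : {A : Set} (xs : List A) (t : A → ℤ) → ∑ xs t * ∑ xs t ≤ ∑ xs (λ _ → 1ℤ) * ∑ xs (λ x → t x * t x)
  cauchy-schwarz []       t = ℤ.≤-refl
  cauchy-schwarz (x ∷ xs) t = begin
    (t x + S) * (t x + S)
      ≡⟨ square (t x) S ⟩
    t x * t x + ((t x * S + S * t x) + S * S)
      ≤⟨ ℤ.+-monoʳ-≤ (t x * t x) (ℤ.+-mono-≤ cross (cauchy-schwarz xs t)) ⟩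
    t x * t x + ((k * (t x * t x) + N) + k * N)
      ≡⟨ collect (t x) k N ⟩
    (1ℤ + k) * (t x * t x + N) ∎
    where
    open ℤ.≤-Reasoning
    S k N : ℤ
    S = ∑ xs t
    k = ∑ xs (λ _ → 1ℤ)
    N = ∑ xs (λ y → t y * t y)
    square : ∀ a s → (a + s) * (a + s) ≡ a * a + ((a * s + s * a) + s * s)
    square = solve-∀
    collect : ∀ a k q → a * a + ((k * (a * a) + q) + k * q) ≡ (1ℤ + k) * (a * a + q)
    collect = solve-∀
    cross : t x * S + S * t x ≤ k * (t x * t x) + N
    cross = i≡j+k⇒j≤i (expanded xs) (∑-nonneg xs (λ y → square-nonneg (t x - t y)))
      where
      expanded : ∀ ys → ∑ ys (λ _ → 1ℤ) * (t x * t x) + ∑ ys (λ y → t y * t y) ≡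
                        (t x * ∑ ys t + ∑ ys t * t x) + ∑ ys (λ y → (t x - t y) * (t x - t y))
      expanded []       = base (t x)
        where
        base : ∀ a → 0ℤ * (a * a) + 0ℤ ≡ (a * 0ℤ + 0ℤ * a) + 0ℤ
        base = solve-∀
      expanded (y ∷ ys) = step (t x) (t y) (∑ ys (λ _ → 1ℤ)) (∑ ys (λ y → t y * t y)) (∑ ys t) _ (expanded ys)
        where
        step : ∀ a b k q s d → k * (a * a) + q ≡ (a * s + s * a) + d →
               (1ℤ + k) * (a * a) + (b * b + q) ≡ (a * (b + s) + (b + s) * a) + ((a - b) * (a - b) + d)
        step a b k q s d eq = trans (left a b k q) (trans (cong (_+ (a * a + b * b)) eq) (right a b s d))
          where
          left : ∀ a b k q → (1ℤ + k) * (a * a) + (b * b + q) ≡ (k * (a * a) + q) + (a * a + b * b)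
          left = solve-∀
          right : ∀ a b s d → ((a * s + s * a) + d) + (a * a + b * b) ≡ (a * (b + s) + (b + s) * a) + ((a - b) * (a - b) + d)
          right = solve-∀

  -- Dirichlet energy, uniqueness, and identities between forest counts

  module Potential {n m : ℕ} (G : Multigraph n m) where
    open Multigraph G
    open Connectivity G
    open Forests G
    open Counting G
    open ≡-Reasoning

    -- A forest in which `x` and `y` share a component may be rooted there at either of them.
    green-sym : ∀ Z x y → green Z y x ≡ green Z x y
    green-sym Z x y = ∑-cong 𝒫 λ H → trans
      (𝟙-× (rootedForest? (y ∷ Z) H) (conn? H x y) (both? H) (λ z → z) _,_)
      (sym (𝟙-× (rootedForest? (x ∷ Z) H) (conn? H y x) (both? H)
        (λ (F , c) → change-root c F , conn-sym c) (λ F c → change-root c F , conn-sym c)))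
      where
      both? : ∀ H → Dec (RootedForest (y ∷ Z) H × Conn G H x y)
      both? H = rootedForest? (y ∷ Z) H ×-dec conn? H x y

    green-root : ∀ {Z z} y → z ∈ˡ Z → green Z y z ≡ 0ℤ
    green-root {Z} {z} y z∈ = trans (∑-cong 𝒫 λ H →
      𝟙-× (rootedForest? (y ∷ Z) H) (conn? H z y) (no (λ x → x)) (λ ()) (absurd H)) (∑-zero 𝒫)
      where
      open RootedForest
      absurd : ∀ H → RootedForest (y ∷ Z) H → ¬ Conn G H z y
      absurd H F c with separates F
      ... | ≁ ∷ _ = All.lookup ≁ z∈ (conn-sym c)

    green-diag : ∀ Z x → green Z x x ≡ forestCount (x ∷ Z)
    green-diag Z x = ∑-cong 𝒫 λ H → trans
      (cong (𝟙 (rootedForest? (x ∷ Z) H) *_) (𝟙-yes (conn? H x x) conn-refl)) (*-identityʳ _)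

    laplacian-green : ∀ {Z x} y → x ∉ˡ Z → laplacian (green Z y) x ≡ 𝟙 (x ≟ y) * forestCount Z
    laplacian-green {Z} {x} y x∉ = go (x ≟ y)
      where
      go : (d : Dec (x ≡ y)) → laplacian (green Z y) x ≡ 𝟙 d * forestCount Z
      go (yes refl) = trans (laplacian-green-pole x∉) (sym (*-identityˡ (forestCount Z)))
      go (no x≢y)   = trans (laplacian-green-harmonic x∉ x≢y) (sym (*-zeroˡ (forestCount Z)))

    -- Without loops the two orientations of an edge are different ordered pairs, so the indicator
    -- of `Joins` is the sum of two products of deltas.
    ∑-mult : (k : Fin n → Fin n → ℤ) →
      ∑ V (λ x → ∑ V (λ u → mult x u * k x u)) ≡ ∑ E (λ e → k (src e) (tgt e) + k (tgt e) (src e))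
    ∑-mult k = begin
      ∑ V (λ x → ∑ V (λ u → mult x u * k x u))
        ≡⟨ ∑-cong V (λ x → sym (∑-joins x (k x))) ⟩
      ∑ V (λ x → ∑ E (λ e → ∑ V (λ u → 𝟙 (joins? e x u) * k x u)))
        ≡⟨ ∑-swap V E _ ⟩
      ∑ E (λ e → ∑ V (λ x → ∑ V (λ u → 𝟙 (joins? e x u) * k x u)))
        ≡⟨ ∑-cong E (λ e → ends e) ⟩
      ∑ E (λ e → k (src e) (tgt e) + k (tgt e) (src e)) ∎
      where
      orient : ∀ e x u → 𝟙 (joins? e x u) * k x u ≡
        𝟙 (x ≟ src e) * (𝟙 (u ≟ tgt e) * k x u) + 𝟙 (x ≟ tgt e) * (𝟙 (u ≟ src e) * k x u)
      orient e x u with x ≟ src e | u ≟ tgt e | x ≟ tgt e | u ≟ src e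
      ... | yes refl | _        | yes p    | _        = ⊥-elim (loopless e p)
      ... | _        | yes refl | _        | yes p    = ⊥-elim (loopless e (sym p))
      ... | yes refl | yes refl | no _     | no _     = trans (cong (_* k x u) (𝟙-yes (joins? e x u) (inj₁ (refl , refl)))) (one (k x u))
        where
        one : ∀ a → 1ℤ * a ≡ 1ℤ * (1ℤ * a) + 0ℤ * (0ℤ * a)
        one = solve-∀
      ... | no _     | no _     | yes refl | yes refl = trans (cong (_* k x u) (𝟙-yes (joins? e x u) (inj₂ (refl , refl)))) (one (k x u))
        where
        one : ∀ a → 1ℤ * a ≡ 0ℤ * (0ℤ * a) + 1ℤ * (1ℤ * a)
        one = solve-∀
      ... | yes refl | no p     | no _     | d        =
        trans (cong (_* k x u) (𝟙-no (joins? e x u) λ { (inj₁ (_ , r)) → p (sym r) ; (inj₂ (_ , r)) → loopless e (sym r) }))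
        (zero′ (𝟙 d) (k x u))
        where
        zero′ : ∀ c a → 0ℤ * a ≡ 1ℤ * (0ℤ * a) + 0ℤ * (c * a)
        zero′ = solve-∀
      ... | no p     | b        | yes refl | no r     =
        trans (cong (_* k x u) (𝟙-no (joins? e x u) λ { (inj₁ (s , _)) → p (sym s) ; (inj₂ (s , _)) → r (sym s) }))
        (zero′ (𝟙 b) (k x u))
        where
        zero′ : ∀ c a → 0ℤ * a ≡ 0ℤ * (c * a) + 1ℤ * (0ℤ * a)
        zero′ = solve-∀
      ... | no p     | b        | no r     | d        =
        trans (cong (_* k x u) (𝟙-no (joins? e x u) λ { (inj₁ (s , _)) → p (sym s) ; (inj₂ (_ , s)) → r (sym s) }))
        (zero′ (𝟙 b) (𝟙 d) (k x u))
        where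
        zero′ : ∀ b c a → 0ℤ * a ≡ 0ℤ * (b * a) + 0ℤ * (c * a)
        zero′ = solve-∀

      δδ : ∀ a b → ∑ V (λ x → ∑ V (λ u → 𝟙 (x ≟ a) * (𝟙 (u ≟ b) * k x u))) ≡ k a b
      δδ a b = begin
        ∑ V (λ x → ∑ V (λ u → 𝟙 (x ≟ a) * (𝟙 (u ≟ b) * k x u)))
          ≡⟨ ∑-cong V (λ x → ∑-*ˡ V (𝟙 (x ≟ a)) (λ u → 𝟙 (u ≟ b) * k x u)) ⟩
        ∑ V (λ x → 𝟙 (x ≟ a) * ∑ V (λ u → 𝟙 (u ≟ b) * k x u))
          ≡⟨ ∑-δ _≟_ V (allFin⁺ n) (λ x → ∑ V (λ u → 𝟙 (u ≟ b) * k x u)) (∈-allFin a) ⟩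
        ∑ V (λ u → 𝟙 (u ≟ b) * k a u)
          ≡⟨ ∑-δ _≟_ V (allFin⁺ n) (k a) (∈-allFin b) ⟩
        k a b ∎

      ends : ∀ e → ∑ V (λ x → ∑ V (λ u → 𝟙 (joins? e x u) * k x u)) ≡ k (src e) (tgt e) + k (tgt e) (src e)
      ends e = begin
        ∑ V (λ x → ∑ V (λ u → 𝟙 (joins? e x u) * k x u))
          ≡⟨ ∑-cong V (λ x → trans (∑-cong V (orient e x)) (∑-+ V _ _)) ⟩
        ∑ V (λ x → ∑ V (λ u → 𝟙 (x ≟ src e) * (𝟙 (u ≟ tgt e) * k x u)) + ∑ V (λ u → 𝟙 (x ≟ tgt e) * (𝟙 (u ≟ src e) * k x u)))
          ≡⟨ ∑-+ V _ _ ⟩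
        ∑ V (λ x → ∑ V (λ u → 𝟙 (x ≟ src e) * (𝟙 (u ≟ tgt e) * k x u))) + ∑ V (λ x → ∑ V (λ u → 𝟙 (x ≟ tgt e) * (𝟙 (u ≟ src e) * k x u)))
          ≡⟨ cong₂ _+_ (δδ (src e) (tgt e)) (δδ (tgt e) (src e)) ⟩
        k (src e) (tgt e) + k (tgt e) (src e) ∎

    energy : ∀ f → ∑ V (λ x → f x * laplacian f x) ≡ ∑ E (λ e → (f (src e) - f (tgt e)) * (f (src e) - f (tgt e)))
    energy f = begin
      ∑ V (λ x → f x * laplacian f x)
        ≡⟨ ∑-cong V (λ x → trans (sym (∑-*ˡ V (f x) _)) (∑-cong V (λ u → rearrange (f x) (mult x u) (f u)))) ⟩
      ∑ V (λ x → ∑ V (λ u → mult x u * (f x * (f x - f u))))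
        ≡⟨ ∑-mult (λ x u → f x * (f x - f u)) ⟩
      ∑ E (λ e → f (src e) * (f (src e) - f (tgt e)) + f (tgt e) * (f (tgt e) - f (src e)))
        ≡⟨ ∑-cong E (λ e → square (f (src e)) (f (tgt e))) ⟩
      ∑ E (λ e → (f (src e) - f (tgt e)) * (f (src e) - f (tgt e))) ∎
      where
      rearrange : ∀ a c b → a * (c * (a - b)) ≡ c * (a * (a - b))
      rearrange = solve-∀
      square : ∀ a b → a * (a - b) + b * (b - a) ≡ (a - b) * (a - b)
      square = solve-∀

    -- Every product `f x * laplacian f x` is zero, hence so is the energy. As a sum of squares it
    -- forces `f` to agree at the ends of each edge, and connectedness carries the value at `q`
    -- everywhere.
    dirichlet-unique : Connected G → ∀ {q} (f : Fin n → ℤ) → f q ≡ 0ℤ → (∀ x → f x ≡ 0ℤ ⊎ laplacian f x ≡ 0ℤ) → ∀ x → f x ≡ 0ℤ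
    dirichlet-unique connected {q} f fq≡0 harmonic x = trans (along (proj₂ (connected x q))) fq≡0
      where
      sq : Fin m → ℤ
      sq e = (f (src e) - f (tgt e)) * (f (src e) - f (tgt e))
      zero-energy : ∑ E sq ≡ 0ℤ
      zero-energy = trans (sym (energy f)) (trans (∑-cong V (λ v → no-work v (harmonic v))) (∑-zero V))
        where
        no-work : ∀ v → f v ≡ 0ℤ ⊎ laplacian f v ≡ 0ℤ → f v * laplacian f v ≡ 0ℤ
        no-work v (inj₁ p) = trans (cong (_* laplacian f v) p) (*-zeroˡ (laplacian f v))
        no-work v (inj₂ p) = trans (cong (f v *_) p) (*-zeroʳ (f v))
      flat : ∀ e → f (src e) ≡ f (tgt e)
      flat e = ℤ.i-j≡0⇒i≡j _ _ ([ (λ z → z) , (λ z → z) ]′ (ℤ.i*j≡0⇒i≡0∨j≡0 (f (src e) - f (tgt e))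
        (ℤ.≤-antisym (subst (sq e ≤_) zero-energy (∑-∈-≤ E (λ e → square-nonneg (f (src e) - f (tgt e))) (∈-allFin e)))
          (square-nonneg (f (src e) - f (tgt e))))))
      along : ∀ {S u v es} → Walk G S u v es → f u ≡ f v
      along nil                               = refl
      along (cons {e = e} _ (inj₁ (refl , refl)) p) = trans (flat e) (along p)
      along (cons {e = e} _ (inj₂ (refl , refl)) p) = trans (sym (flat e)) (along p)

    laplacian-combination : ∀ k l p (f g h : Fin n → ℤ) x →
      laplacian (λ v → k * f v - (g v * l - h v * p)) x ≡ k * laplacian f x - (laplacian g x * l - laplacian h x * p)
    laplacian-combination k l p f g h x = begin
      laplacian (λ v → k * f v - (g v * l - h v * p)) x
        ≡⟨ ∑-cong V (λ u → rearrange (mult x u) k l p (f x) (f u) (g x) (g u) (h x) (h u)) ⟩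
      ∑ V (λ u → k * (mult x u * (f x - f u)) - (mult x u * (g x - g u) * l - mult x u * (h x - h u) * p))
        ≡⟨ trans (∑-- V δf (λ u → δg u - δh u)) (cong (λ s → ∑ V δf - s) (∑-- V δg δh)) ⟩
      ∑ V (λ u → k * (mult x u * (f x - f u))) -
        (∑ V (λ u → mult x u * (g x - g u) * l) - ∑ V (λ u → mult x u * (h x - h u) * p))
        ≡⟨ cong₂ _-_ (∑-*ˡ V k _) (cong₂ _-_ (∑-*ʳ V l _) (∑-*ʳ V p _)) ⟩
      k * laplacian f x - (laplacian g x * l - laplacian h x * p) ∎
      where
      δf δg δh : Fin n → ℤ
      δf u = k * (mult x u * (f x - f u))
      δg u = mult x u * (g x - g u) * l
      δh u = mult x u * (h x - h u) * p
      rearrange : ∀ c k l p fx fu gx gu hx hu →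
        c * ((k * fx - (gx * l - hx * p)) - (k * fu - (gu * l - hu * p))) ≡
        k * (c * (fx - fu)) - (c * (gx - gu) * l - c * (hx - hu) * p)
      rearrange = solve-∀

    -- Two-forests in terms of the Green function with root q

    module _ (q : Fin n) where

      g : Fin n → Fin n → ℤ
      g x y = green (q ∷ []) y x

      R : Fin n → ℤ
      R x = g x x

      τ : ℤ
      τ = forestCount (q ∷ [])

      private
        side? : ∀ a b H → Dec (RootedForest (a ∷ b ∷ []) H × Conn G H q b)
        side? a b H = rootedForest? (a ∷ b ∷ []) H ×-dec conn? H q b

        -- Among the two-forests cutting `a` from `q`, counted by `R a`, the term `g b a` removes
        -- those keeping `b` with `a`. In the remaining ones `b` lies with `q` and can replace it as
        -- a root.
        side : ∀ a b → R a - g b a ≡ ∑ 𝒫 (λ H → 𝟙 (side? a b H))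
        side a b = trans (sym (∑-- 𝒫 _ _)) (∑-cong 𝒫 pointwise)
          where
          to : ∀ {H} → RootedForest (a ∷ b ∷ []) H × Conn G H q b → RootedForest (a ∷ q ∷ []) H × ¬ Conn G H b a
          to (F , c) = swap-roots (change-root c (swap-roots F)) , rooted⇒separated (swap-roots F)
          from : ∀ {H} → RootedForest (a ∷ q ∷ []) H → ¬ Conn G H b a → RootedForest (a ∷ b ∷ []) H × Conn G H q b
          from F b≁a with RootedForest.covers F b
          ... | here p         = ⊥-elim (b≁a p)
          ... | there (here p) = swap-roots (change-root p (swap-roots F)) , conn-sym p
          pointwise : ∀ H →
            𝟙 (rootedForest? (a ∷ q ∷ []) H) * 𝟙 (conn? H a a) - 𝟙 (rootedForest? (a ∷ q ∷ []) H) * 𝟙 (conn? H b a) ≡ 𝟙 (side? a b H)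
          pointwise H = begin
            F * 𝟙 (conn? H a a) - F * 𝟙 (conn? H b a)
              ≡⟨ cong (λ k → F * k - F * 𝟙 (conn? H b a)) (𝟙-yes (conn? H a a) conn-refl) ⟩
            F * 1ℤ - F * 𝟙 (conn? H b a)
              ≡⟨ factor F (𝟙 (conn? H b a)) ⟩
            F * (1ℤ - 𝟙 (conn? H b a))
              ≡⟨ cong (F *_) (𝟙-¬ (conn? H b a)) ⟨
            F * 𝟙 (¬? (conn? H b a))
              ≡⟨ 𝟙-× (rootedForest? (a ∷ q ∷ []) H) (¬? (conn? H b a)) (side? a b H) to from ⟩
            𝟙 (side? a b H) ∎
            where
            F = 𝟙 (rootedForest? (a ∷ q ∷ []) H)
            factor : ∀ f k → f * 1ℤ - f * k ≡ f * (1ℤ - k)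
            factor = solve-∀

      -- Split according to whether `q` lies with `b` or with `a`. Divided by `τ`, this is the
      -- formula for the effective resistance between `a` and `b`.
      separatingForests : ∀ a b → forestCount (a ∷ b ∷ []) ≡ R a + R b - (g a b + g a b)
      separatingForests a b = begin
        forestCount (a ∷ b ∷ [])
          ≡⟨ ∑-cong 𝒫 which-side ⟩
        ∑ 𝒫 (λ H → 𝟙 (side? a b H) + 𝟙 (side? b a H))
          ≡⟨ ∑-+ 𝒫 _ _ ⟩
        ∑ 𝒫 (λ H → 𝟙 (side? a b H)) + ∑ 𝒫 (λ H → 𝟙 (side? b a H))
          ≡⟨ cong₂ _+_ (side a b) (side b a) ⟨
        (R a - g b a) + (R b - g a b)
          ≡⟨ cong (λ k → (R a - k) + (R b - g a b)) (green-sym (q ∷ []) b a) ⟩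
        (R a - g a b) + (R b - g a b)
          ≡⟨ rearrange (R a) (R b) (g a b) ⟩
        R a + R b - (g a b + g a b) ∎
        where
        rearrange : ∀ x y z → (x - z) + (y - z) ≡ x + y - (z + z)
        rearrange = solve-∀
        which-side : ∀ H → 𝟙 (rootedForest? (a ∷ b ∷ []) H) ≡ 𝟙 (side? a b H) + 𝟙 (side? b a H)
        which-side H with rootedForest? (a ∷ b ∷ []) H
        ... | no ¬F = sym (cong (0ℤ +_) (𝟙-no (side? b a H) (λ (F , _) → ¬F (swap-roots F))))
        ... | yes F with conn? H q b
        ...   | yes q~b = sym (cong (1ℤ +_) (𝟙-no (side? b a H) (λ (_ , q~a) → rooted⇒separated F (conn-trans (conn-sym q~a) q~b))))
        ...   | no q≁b  = sym (cong (0ℤ +_) (𝟙-yes (side? b a H) (swap-roots F , q~a (RootedForest.covers F q))))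
          where
          q~a : Any (Conn G H q) (a ∷ b ∷ []) → Conn G H q a
          q~a (here p)         = p
          q~a (there (here p)) = ⊥-elim (q≁b p)

      -- Both sides, as functions of the vertex at which the component of a is tested, solve the same Dirichlet problem.
      threeForests : Connected G → ∀ a b → τ * forestCount (a ∷ b ∷ q ∷ []) ≡ R a * R b - g a b * g a b
      threeForests connected a b = begin
        τ * forestCount (a ∷ b ∷ q ∷ [])
          ≡⟨ cong (τ *_) (green-diag (b ∷ q ∷ []) a) ⟨
        τ * green (b ∷ q ∷ []) a a
          ≡⟨ ℤ.i-j≡0⇒i≡j _ _ (dirichlet-unique connected d d-q harmonic a) ⟩
        R a * R b - g a b * g a b ∎
        where
        -- To create a further zero at `b`, the potential with pole `a` is corrected by the multiple
        -- of the potential with pole `b` that cancels it there; scaling by `R b` avoids the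
        -- quotient `g a b / R b`.
        d : Fin n → ℤ
        d x = τ * green (b ∷ q ∷ []) a x - (g x a * R b - g x b * g a b)

        vanish : ∀ t r s → t * 0ℤ - (0ℤ * r - 0ℤ * s) ≡ 0ℤ
        vanish = solve-∀

        d-q : d q ≡ 0ℤ
        d-q = begin
          τ * green (b ∷ q ∷ []) a q - (g q a * R b - g q b * g a b)
            ≡⟨ cong₂ (λ k l → τ * k - (l * R b - g q b * g a b)) (green-root a (there (here refl))) (green-root a (here refl)) ⟩
          τ * 0ℤ - (0ℤ * R b - g q b * g a b)
            ≡⟨ cong (λ k → τ * 0ℤ - (0ℤ * R b - k * g a b)) (green-root b (here refl)) ⟩
          τ * 0ℤ - (0ℤ * R b - 0ℤ * g a b)
            ≡⟨ vanish τ (R b) (g a b) ⟩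
          0ℤ ∎

        d-b : d b ≡ 0ℤ
        d-b = begin
          τ * green (b ∷ q ∷ []) a b - (g b a * R b - g b b * g a b)
            ≡⟨ cong₂ (λ k l → τ * k - (l * R b - g b b * g a b)) (green-root a (here refl)) (green-sym (q ∷ []) b a) ⟩
          τ * 0ℤ - (g a b * R b - R b * g a b)
            ≡⟨ cancel τ (g a b) (R b) ⟩
          0ℤ ∎
          where
          cancel : ∀ t k r → t * 0ℤ - (k * r - r * k) ≡ 0ℤ
          cancel = solve-∀

        harmonic : ∀ x → d x ≡ 0ℤ ⊎ laplacian d x ≡ 0ℤ
        harmonic x = go (x ≟ q) (x ≟ b)
          where
          go : Dec (x ≡ q) → Dec (x ≡ b) → d x ≡ 0ℤ ⊎ laplacian d x ≡ 0ℤ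
          go (yes refl) _          = inj₁ d-q
          go (no _)     (yes refl) = inj₁ d-b
          go (no x≢q)   (no x≢b)   = inj₂ (begin
            laplacian d x
              ≡⟨ laplacian-combination τ (R b) (g a b) (green (b ∷ q ∷ []) a) (λ v → g v a) (λ v → g v b) x ⟩
            τ * laplacian (green (b ∷ q ∷ []) a) x - (laplacian (λ v → g v a) x * R b - laplacian (λ v → g v b) x * g a b)
              ≡⟨ cong₂ (λ k l → τ * k - (l * R b - laplacian (λ v → g v b) x * g a b))
                   (laplacian-green a (λ { (here p) → x≢b p ; (there (here p)) → x≢q p })) (laplacian-green a x∉) ⟩
            τ * (𝟙 (x ≟ a) * forestCount (b ∷ q ∷ [])) - (𝟙 (x ≟ a) * τ * R b - laplacian (λ v → g v b) x * g a b)
              -- The poles at `a` have equal strength: `forestCount (b ∷ q ∷ [])`, which is `R b`,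
              -- scaled by `τ` on one side, and `τ` scaled by `R b` on the other.
              ≡⟨ cong₂ (λ k l → τ * (𝟙 (x ≟ a) * k) - (𝟙 (x ≟ a) * τ * R b - l * g a b))
                   (sym (green-diag (q ∷ []) b)) (laplacian-green-harmonic x∉ x≢b) ⟩
            τ * (𝟙 (x ≟ a) * R b) - (𝟙 (x ≟ a) * τ * R b - 0ℤ * g a b)
              ≡⟨ cancel τ (𝟙 (x ≟ a)) (R b) (g a b) ⟩
            0ℤ ∎)
            where
            x∉ : x ∉ˡ q ∷ []
            x∉ (here p) = x≢q p
            cancel : ∀ t i r k → t * (i * r) - (i * t * r - 0ℤ * k) ≡ 0ℤ
            cancel = solve-∀

      -- The Laplacian is taken at the pole, which moves with `x`. Summed over `x` this gives
      -- `∑-separatingForests`; weighted by `R x` it gives `R-sum`.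
      degree-identity : ∀ x → ∑ V (λ u → mult x u * (R x - g x u)) ≡ (1ℤ - 𝟙 (x ≟ q)) * τ
      degree-identity x = trans (∑-cong V (λ u → cong (λ k → mult x u * (R x - k)) (green-sym (q ∷ []) x u))) (lap (x ≟ q))
        where
        lap : (d : Dec (x ≡ q)) → laplacian (λ v → g v x) x ≡ (1ℤ - 𝟙 d) * τ
        lap (no x≢q)   = trans (laplacian-green-pole (λ { (here p) → x≢q p })) (sym (*-identityˡ τ))
        lap (yes refl) = trans (∑-cong V (λ u → trans
            (cong₂ (λ k l → mult x u * (k - l)) (green-root q (here refl)) (trans (green-sym (q ∷ []) u q) (green-root u (here refl))))
            (*-zeroʳ (mult x u)))) (trans (∑-zero V) (sym (*-zeroˡ τ)))

      -- Foster's theorem, cleared of denominators: the effective resistances of the edges add up to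
      -- n - 1.
      ∑-separatingForests : ∑ E (λ e → forestCount (src e ∷ tgt e ∷ [])) ≡ (pos n - 1ℤ) * τ
      ∑-separatingForests = begin
        ∑ E (λ e → forestCount (src e ∷ tgt e ∷ []))
          ≡⟨ ∑-cong E (λ e → trans (separatingForests (src e) (tgt e)) (trans (rearrange (R (src e)) (R (tgt e)) (g (src e) (tgt e)))
               (cong (λ k → (R (src e) - g (src e) (tgt e)) + (R (tgt e) - k)) (green-sym (q ∷ []) (src e) (tgt e))))) ⟩
        ∑ E (λ e → (R (src e) - g (src e) (tgt e)) + (R (tgt e) - g (tgt e) (src e)))
          ≡⟨ ∑-mult (λ x u → R x - g x u) ⟨
        ∑ V (λ x → ∑ V (λ u → mult x u * (R x - g x u)))
          ≡⟨ ∑-cong V degree-identity ⟩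
        ∑ V (λ x → (1ℤ - 𝟙 (x ≟ q)) * τ)
          ≡⟨ ∑-*ʳ V τ (λ x → 1ℤ - 𝟙 (x ≟ q)) ⟩
        ∑ V (λ x → 1ℤ - 𝟙 (x ≟ q)) * τ
          ≡⟨ cong (_* τ) (trans (∑-- V _ _) (cong₂ _-_ (trans (∑-one V) (cong pos (length-tabulate {n = n} (λ z → z))))
               (trans (∑-cong V (λ x → sym (*-identityʳ (𝟙 (x ≟ q))))) (∑-δ _≟_ V (allFin⁺ n) (λ _ → 1ℤ) (∈-allFin q))))) ⟩
        (pos n - 1ℤ) * τ ∎
        where
        rearrange : ∀ x y z → x + y - (z + z) ≡ (x - z) + (y - z)
        rearrange = solve-∀

      -- The defect of `degree-identity` at `q` disappears under the weight, since `R q` is zero.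
      R-sum : τ * ∑ V R ≡ ∑ E (λ e → R (src e) * (R (src e) - g (src e) (tgt e)) + R (tgt e) * (R (tgt e) - g (tgt e) (src e)))
      R-sum = begin
        τ * ∑ V R
          ≡⟨ ∑-*ˡ V τ R ⟨
        ∑ V (λ x → τ * R x)
          ≡⟨ ∑-cong V (λ x → trans (off-root x (x ≟ q)) (trans (cong (R x *_) (sym (degree-identity x)))
               (trans (sym (∑-*ˡ V (R x) _)) (∑-cong V (λ u → rearrange (R x) (mult x u) (R x - g x u)))))) ⟩
        ∑ V (λ x → ∑ V (λ u → mult x u * (R x * (R x - g x u))))
          ≡⟨ ∑-mult (λ x u → R x * (R x - g x u)) ⟩
        ∑ E (λ e → R (src e) * (R (src e) - g (src e) (tgt e)) + R (tgt e) * (R (tgt e) - g (tgt e) (src e))) ∎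
        where
        rearrange : ∀ a c b → a * (c * b) ≡ c * (a * b)
        rearrange = solve-∀
        off-root : ∀ x (d : Dec (x ≡ q)) → τ * R x ≡ R x * ((1ℤ - 𝟙 d) * τ)
        off-root x (no _)     = swap τ (R x)
          where
          swap : ∀ t r → t * r ≡ r * ((1ℤ - 0ℤ) * t)
          swap = solve-∀
        off-root x (yes refl) = trans (cong (τ *_) (green-root q (here refl)))
          (trans (both τ) (cong (_* (0ℤ * τ)) (sym (green-root q (here refl)))))
          where
          both : ∀ t → t * 0ℤ ≡ 0ℤ * (0ℤ * t)
          both = solve-∀

  -- A lower bound for the number of two-forests

  module TwoForests {n m : ℕ} (G : Multigraph n m) where
    open Multigraph G
    open Connectivity G
    open Forests G
    open Counting G
    open Potential G

    twoForestCount : ℤ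
    twoForestCount = ∑ 𝒫 (λ F → 𝟙 (isTwoForest? F))

    module _ (q : Fin n) where

      private
        -- For a two-forest `F` this says that `e` is an edge of the component avoiding `q`:
        -- deleting an edge of the other component would leave one of its ends with `q`.
        Detaches : Subset m → Fin m → Set
        Detaches F e = e ∈ F × RootedForest (src e ∷ tgt e ∷ q ∷ []) (del e F)

        detaches? : ∀ F e → Dec (Detaches F e)
        detaches? F e = (e ∈? F) ×-dec rootedForest? (src e ∷ tgt e ∷ q ∷ []) (del e F)

        -- The component avoiding q is a tree: all its vertices but one choose distinct parent edges in it.
        euler : ∀ F → ∑ V (λ w → 𝟙 (rootedForest? (w ∷ q ∷ []) F)) ≤ 𝟙 (isTwoForest? F) + ∑ E (λ e → 𝟙 (detaches? F e))
        euler F with any? (λ y → rootedForest? (y ∷ q ∷ []) F)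
        ... | no none = subst (_≤ 𝟙 (isTwoForest? F) + ∑ E (λ e → 𝟙 (detaches? F e)))
                        (sym (∑-none (λ w → rootedForest? (w ∷ q ∷ []) F) V (All.tabulate (λ {w} _ p → none (w , p)))))
                          (ℤ.+-mono-≤ (𝟙≥0 (isTwoForest? F)) (∑-nonneg E (λ e → 𝟙≥0 (detaches? F e))))
        ... | yes (y , Fy) = counted
          where
          -- The tree is rooted at `y`, and `e` is the edge by which `w` starts towards `y`; the
          -- last conjunct puts `w` on the side of `e` away from `y`.
          ChosenBy : Fin n → Fin m → Set
          ChosenBy w e = Detaches F e × (∃ λ u → Joins G e w u) × RootedForest (w ∷ y ∷ q ∷ []) (del e F)
          chosenBy? : ∀ w e → Dec (ChosenBy w e)
          chosenBy? w e = detaches? F e ×-dec any? (joins? e w) ×-dec rootedForest? (w ∷ y ∷ q ∷ []) (del e F)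

          choice : ∀ {w} → w ≢ y → RootedForest (w ∷ q ∷ []) F → ∃ λ e → ChosenBy w e
          choice {w} w≢y Fw = pick (parentEdge-exists w∉ Fy)
            where
            w∉ : w ∉ˡ y ∷ q ∷ []
            w∉ (here p)            = w≢y p
            w∉ (there (here refl)) = rooted⇒separated Fw conn-refl
            w~y : Conn G F w y
            w~y with RootedForest.covers Fy w
            ... | here p         = p
            ... | there (here p) = ⊥-elim (rooted⇒separated Fw p)
            orient : ∀ {e u} → Joins G e w u → RootedForest (w ∷ u ∷ q ∷ []) (del e F) → RootedForest (src e ∷ tgt e ∷ q ∷ []) (del e F)
            orient (inj₁ (refl , refl)) H = H
            orient (inj₂ (refl , refl)) H = swap-roots H
            pick : (∃₂ λ e u → ParentEdge (y ∷ q ∷ []) F w e u) → ∃ λ e → ChosenBy w e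
            pick (e , u , e∈ , j , H , u≁w) = e , (e∈ , orient j (swap-roots (change-root u~y (swap-roots H)))) , (u , j) , H
              where
              u~y : Conn G (del e F) u y
              u~y with RootedForest.covers H u
              ... | here p                 = ⊥-elim (u≁w p)
              ... | there (here p)         = p
              ... | there (there (here p)) = ⊥-elim (rooted⇒separated Fw (conn-trans (conn-edge e∈ j) (conn-mono del-⊆ p)))

          -- Two choosers would be the two ends of `e`. Once `e` is deleted, `w′` would be apart
          -- from `w`, from `y` and from `q`, yet these three represent all components.
          chooser-unique : ∀ {e w w′} → ChosenBy w e → ChosenBy w′ e → w ≡ w′
          chooser-unique {e} {w} {w′} ((_ , H₃) , (u , j) , H) (_ , (u′ , j′) , H′) with w ≟ w′
          ... | yes p = p
          ... | no w≢w′ = ⊥-elim (absurd (RootedForest.covers H w′) (RootedForest.separates H′))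
            where
            ends : ∀ {e u u′} → Joins G e w u → Joins G e w′ u′ → Joins G e w w′
            ends (inj₁ (refl , refl)) (inj₁ (refl , refl)) = ⊥-elim (w≢w′ refl)
            ends (inj₁ (refl , refl)) (inj₂ (refl , refl)) = inj₁ (refl , refl)
            ends (inj₂ (refl , refl)) (inj₁ (refl , refl)) = inj₂ (refl , refl)
            ends (inj₂ (refl , refl)) (inj₂ (refl , refl)) = ⊥-elim (w≢w′ refl)
            apart : ∀ {e} → RootedForest (src e ∷ tgt e ∷ q ∷ []) (del e F) → Joins G e w w′ → ¬ Conn G (del e F) w′ w
            apart (forest _ ((≁ ∷ _) ∷ _) _) (inj₁ (refl , refl)) c = ≁ (conn-sym c)
            apart (forest _ ((≁ ∷ _) ∷ _) _) (inj₂ (refl , refl)) c = ≁ c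
            absurd : Any (Conn G (del e F) w′) (w ∷ y ∷ q ∷ []) → ¬ AllPairs (λ a b → ¬ Conn G (del e F) a b) (w′ ∷ y ∷ q ∷ [])
            absurd (here p)                 _                  = apart H₃ (ends j j′) p
            absurd (there (here p))         ((≁ ∷ _) ∷ _)     = ≁ p
            absurd (there (there (here p))) ((_ ∷ ≁ ∷ _) ∷ _) = ≁ p

          vertexwise : ∀ w → 𝟙 (rootedForest? (w ∷ q ∷ []) F) ≤ 𝟙 (w ≟ y) + ∑ E (λ e → 𝟙 (chosenBy? w e))
          vertexwise w = go (w ≟ y)
            where
            go : (d : Dec (w ≡ y)) → 𝟙 (rootedForest? (w ∷ q ∷ []) F) ≤ 𝟙 d + ∑ E (λ e → 𝟙 (chosenBy? w e))
            go (yes _) = ℤ.≤-trans (𝟙-mono (rootedForest? (w ∷ q ∷ []) F) (yes Fy) (λ _ → Fy))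
                          (ℤ.+-monoʳ-≤ 1ℤ (∑-nonneg E (λ e → 𝟙≥0 (chosenBy? w e))))
            go (no w≢y) = subst (𝟙 (rootedForest? (w ∷ q ∷ []) F) ≤_) (sym (ℤ.+-identityˡ _))
                          (∑-atLeastOne (chosenBy? w) (rootedForest? (w ∷ q ∷ []) F) E
                            (λ Fw → let (e , p) = choice w≢y Fw in e , ∈-allFin e , p))

          counted : ∑ V (λ w → 𝟙 (rootedForest? (w ∷ q ∷ []) F)) ≤ 𝟙 (isTwoForest? F) + ∑ E (λ e → 𝟙 (detaches? F e))
          counted = ℤ.≤-trans (∑-mono V vertexwise) (subst (_≤ 𝟙 (isTwoForest? F) + ∑ E (λ e → 𝟙 (detaches? F e)))
            (sym (trans (∑-+ V (λ w → 𝟙 (w ≟ y)) (λ w → ∑ E (λ e → 𝟙 (chosenBy? w e))))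
              (cong (∑ V (λ w → 𝟙 (w ≟ y)) +_) (∑-swap V E (λ w e → 𝟙 (chosenBy? w e))))))
            (ℤ.+-mono-≤ (∑-atMostOne (_≟ y) (isTwoForest? F) V (allFin⁺ n) (λ _ → rooted⇒twoForest Fy) (λ p r → trans p (sym r)))
              (∑-mono E (λ e → ∑-atMostOne (λ w → chosenBy? w e) (detaches? F e) V (allFin⁺ n) proj₁ chooser-unique))))

        -- Deleting `e` is injective on the edge sets containing `e`, so each `F` may be counted
        -- through the three-forest that it leaves.
        detached : ∀ e → ∑ 𝒫 (λ F → 𝟙 (detaches? F e)) ≤ forestCount (src e ∷ tgt e ∷ q ∷ [])
        detached e = subst (_≤ forestCount (src e ∷ tgt e ∷ q ∷ [])) (sym reindexed)
          (∑-mono 𝒫 (λ H → 𝟙-mono (attachable? H) (rootedForest? (src e ∷ tgt e ∷ q ∷ []) H) proj₂))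
          where
          attachable? : ∀ H → Dec (e ∉ H × RootedForest (src e ∷ tgt e ∷ q ∷ []) H)
          attachable? H = ¬? (e ∈? H) ×-dec rootedForest? (src e ∷ tgt e ∷ q ∷ []) H
          reindexed : ∑ 𝒫 (λ F → 𝟙 (detaches? F e)) ≡ ∑ 𝒫 (λ H → 𝟙 (attachable? H))
          reindexed = trans (∑-cong 𝒫 (λ F → sym (*-identityʳ (𝟙 (detaches? F e))))) (trans
            (∑-reindex _≟ˢ_ _≟ˢ_ (subsets! m) ∈-subsets (subsets! m) ∈-subsets (λ F → detaches? F e) attachable? (del e) (add e)
              (λ (e∈ , H) → (∉-del , H) , add-del e∈)
              (λ (e∉ , H) → (∈-add , subst (RootedForest _) (sym (del-add e∉)) H) , del-add e∉) (λ _ → 1ℤ))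
            (∑-cong 𝒫 (λ H → *-identityʳ (𝟙 (attachable? H)))))

      R-sum-bound : ∑ V (R q) ≤ twoForestCount + ∑ E (λ e → forestCount (src e ∷ tgt e ∷ q ∷ []))
      R-sum-bound = begin
        ∑ V (R q)
          ≡⟨ ∑-cong V (green-diag (q ∷ [])) ⟩
        ∑ V (λ w → ∑ 𝒫 (λ F → 𝟙 (rootedForest? (w ∷ q ∷ []) F)))
          ≡⟨ ∑-swap V 𝒫 (λ w F → 𝟙 (rootedForest? (w ∷ q ∷ []) F)) ⟩
        ∑ 𝒫 (λ F → ∑ V (λ w → 𝟙 (rootedForest? (w ∷ q ∷ []) F)))
          ≤⟨ ∑-mono 𝒫 euler ⟩
        ∑ 𝒫 (λ F → 𝟙 (isTwoForest? F) + ∑ E (λ e → 𝟙 (detaches? F e)))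
          ≡⟨ trans (∑-+ 𝒫 (λ F → 𝟙 (isTwoForest? F)) (λ F → ∑ E (λ e → 𝟙 (detaches? F e))))
             (cong (twoForestCount +_) (∑-swap 𝒫 E (λ F e → 𝟙 (detaches? F e)))) ⟩
        twoForestCount + ∑ E (λ e → ∑ 𝒫 (λ F → 𝟙 (detaches? F e)))
          ≤⟨ ℤ.+-monoʳ-≤ twoForestCount (∑-mono E detached) ⟩
        twoForestCount + ∑ E (λ e → forestCount (src e ∷ tgt e ∷ q ∷ [])) ∎
        where open ℤ.≤-Reasoning

  -- The bound on the total cut size

  module CutSizes {n m : ℕ} (G : Multigraph n m) (connected : Connected G) (q : Fin n) where
    open Multigraph G
    open Connectivity G
    open Forests G
    open Counting G
    open Potential G
    open TwoForests G
    open ℤ.≤-Reasoning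

    t : Fin m → ℤ
    t e = forestCount (src e ∷ tgt e ∷ [])

    τ≥0 : 0ℤ ≤ τ q
    τ≥0 = ∑-nonneg 𝒫 (λ S → 𝟙≥0 (rootedForest? (q ∷ []) S))

    *-mono-τ : ∀ {i j} → i ≤ j → τ q * i ≤ τ q * j
    *-mono-τ = ℤ.*-monoˡ-≤-nonNeg (τ q) {{nonNegative τ≥0}}

    -- `𝒜` is `τ q * ∑ V (R q)` and `ℬ` is `τ q` times the number of pairs of an edge and a
    -- three-forest separating its ends and `q`. The factor 4 completes the square edge by edge, and
    -- the surplus of three copies of `𝒟` is nonnegative.
    ∑t²-bound : ∑ E (λ e → t e * t e) ≤ pos 4 * (τ q * twoForestCount)
    ∑t²-bound = begin
      ∑ E (λ e → t e * t e)
        ≤⟨ i≡j+k⇒j≤i identity (ℤ.+-mono-≤ (ℤ.+-mono-≤ D≥0 D≥0) D≥0) ⟩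
      pos 4 * 𝒜 - pos 4 * ℬ
        ≤⟨ ℤ.+-monoˡ-≤ _ (ℤ.*-monoˡ-≤-nonNeg (pos 4) A≤) ⟩
      pos 4 * (τ q * twoForestCount + ℬ) - pos 4 * ℬ
        ≡⟨ cancel (τ q * twoForestCount) ℬ ⟩
      pos 4 * (τ q * twoForestCount) ∎
      where
      a b c aterm bterm dterm : Fin m → ℤ
      a e = R q (src e)
      b e = R q (tgt e)
      c e = g q (src e) (tgt e)
      aterm e = a e * (a e - c e) + b e * (b e - g q (tgt e) (src e))
      bterm e = a e * b e - c e * c e
      dterm e = (a e - b e) * (a e - b e)
      𝒜 ℬ 𝒟 : ℤ
      𝒜 = ∑ E aterm
      ℬ = ∑ E bterm
      𝒟 = ∑ E dterm

      D≥0 : 0ℤ ≤ 𝒟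
      D≥0 = ∑-nonneg E (λ e → square-nonneg (a e - b e))

      cancel : ∀ x y → pos 4 * (x + y) - pos 4 * y ≡ pos 4 * x
      cancel = solve-∀

      A≤ : 𝒜 ≤ τ q * twoForestCount + ℬ
      A≤ = begin
        𝒜
          ≡⟨ R-sum q ⟨
        τ q * ∑ V (R q)
          ≤⟨ *-mono-τ (R-sum-bound q) ⟩
        τ q * (twoForestCount + ∑ E (λ e → forestCount (src e ∷ tgt e ∷ q ∷ [])))
          ≡⟨ ℤ.*-distribˡ-+ (τ q) twoForestCount _ ⟩
        τ q * twoForestCount + τ q * ∑ E (λ e → forestCount (src e ∷ tgt e ∷ q ∷ []))
          ≡⟨ cong (τ q * twoForestCount +_) (trans (sym (∑-*ˡ E (τ q) _)) (∑-cong E (λ e → threeForests q connected (src e) (tgt e)))) ⟩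
        τ q * twoForestCount + ℬ ∎

      edgewise : ∀ e → pos 4 * aterm e - pos 4 * bterm e ≡ t e * t e + ((dterm e + dterm e) + dterm e)
      edgewise e = trans
        (cong (λ k → pos 4 * (a e * (a e - c e) + b e * (b e - k)) - pos 4 * bterm e) (green-sym (q ∷ []) (tgt e) (src e)))
        (trans (poly (a e) (b e) (c e)) (cong (λ k → k * k + ((dterm e + dterm e) + dterm e)) (sym (separatingForests q (src e) (tgt e)))))
        where
        poly : ∀ a b c → pos 4 * (a * (a - c) + b * (b - c)) - pos 4 * (a * b - c * c) ≡
          (a + b - (c + c)) * (a + b - (c + c)) + (((a - b) * (a - b) + (a - b) * (a - b)) + (a - b) * (a - b))
        poly = solve-∀

      identity : pos 4 * 𝒜 - pos 4 * ℬ ≡ ∑ E (λ e → t e * t e) + ((𝒟 + 𝒟) + 𝒟)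
      identity = begin-equality
        pos 4 * 𝒜 - pos 4 * ℬ
          ≡⟨ cong₂ _-_ (∑-*ˡ E (pos 4) aterm) (∑-*ˡ E (pos 4) bterm) ⟨
        ∑ E (λ e → pos 4 * aterm e) - ∑ E (λ e → pos 4 * bterm e)
          ≡⟨ ∑-- E _ _ ⟨
        ∑ E (λ e → pos 4 * aterm e - pos 4 * bterm e)
          ≡⟨ ∑-cong E edgewise ⟩
        ∑ E (λ e → t e * t e + ((dterm e + dterm e) + dterm e))
          ≡⟨ ∑-+ E (λ e → t e * t e) (λ e → (dterm e + dterm e) + dterm e) ⟩
        ∑ E (λ e → t e * t e) + ∑ E (λ e → (dterm e + dterm e) + dterm e)
          ≡⟨ cong (∑ E (λ e → t e * t e) +_) (trans (∑-+ E (λ e → dterm e + dterm e) dterm) (cong (_+ 𝒟) (∑-+ E dterm dterm))) ⟩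
        ∑ E (λ e → t e * t e) + ((𝒟 + 𝒟) + 𝒟) ∎

    length-E : ∑ E (λ _ → 1ℤ) ≡ pos m
    length-E = trans (∑-one E) (cong pos (length-tabulate {n = m} (λ z → z)))

    ∑t-bound : ∑ E t * (pos n - 1ℤ) ≤ pos m * (pos 4 * twoForestCount)
    ∑t-bound with τ q ℤ.≟ 0ℤ
    -- `τ q` is to be cancelled from the Cauchy-Schwarz estimate. In the case of zero,
    -- `∑-separatingForests` makes the left side vanish.
    ... | yes τ≡0 = begin
      ∑ E t * (pos n - 1ℤ)
        ≡⟨ cong (_* (pos n - 1ℤ)) (trans (∑-separatingForests q) (trans (cong ((pos n - 1ℤ) *_) τ≡0) (*-zeroʳ (pos n - 1ℤ)))) ⟩
      0ℤ * (pos n - 1ℤ)                 ≡⟨ *-zeroˡ (pos n - 1ℤ) ⟩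
      0ℤ                                ≡⟨ *-zeroʳ (pos m) ⟨
      pos m * 0ℤ
        ≤⟨ ℤ.*-monoˡ-≤-nonNeg (pos m) (ℤ.*-monoˡ-≤-nonNeg (pos 4) (∑-nonneg 𝒫 (λ F → 𝟙≥0 (isTwoForest? F)))) ⟩
      pos m * (pos 4 * twoForestCount)  ∎
    ... | no τ≢0 = ℤ.*-cancelˡ-≤-pos _ _ (τ q) {{positive (ℤ.≤∧≢⇒< τ≥0 (λ p → τ≢0 (sym p)))}} (begin
      τ q * (∑ E t * (pos n - 1ℤ))             ≡⟨ rearrange (τ q) (∑ E t) (pos n - 1ℤ) ⟩
      ∑ E t * ((pos n - 1ℤ) * τ q)             ≡⟨ cong (∑ E t *_) (∑-separatingForests q) ⟨
      ∑ E t * ∑ E t                            ≤⟨ cauchy-schwarz E t ⟩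
      ∑ E (λ _ → 1ℤ) * ∑ E (λ e → t e * t e)   ≡⟨ cong (_* ∑ E (λ e → t e * t e)) length-E ⟩
      pos m * ∑ E (λ e → t e * t e)            ≤⟨ ℤ.*-monoˡ-≤-nonNeg (pos m) ∑t²-bound ⟩
      pos m * (pos 4 * (τ q * twoForestCount)) ≡⟨ rearrange′ (pos m) (τ q) twoForestCount ⟩
      τ q * (pos m * (pos 4 * twoForestCount)) ∎)
      where
      rearrange : ∀ x y z → x * (y * z) ≡ y * (z * x)
      rearrange = solve-∀
      rearrange′ : ∀ x y z → x * (pos 4 * (y * z)) ≡ y * (x * (pos 4 * z))
      rearrange′ = solve-∀

    module _ {Fs : List (Subset m)} (Fs-enum : Enumerates (IsTwoForest G) Fs)
             (cut : Subset m → ℕ) (cut-size : ∀ F → F ∈ˡ Fs → HasSize (InCut G F) (cut F)) where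

      inCut? : ∀ F e → Dec (InCut G F e)
      inCut? F e = ¬? (conn? F (src e) (tgt e))

      length-Fs : pos (length Fs) ≡ twoForestCount
      length-Fs = begin-equality
        pos (length Fs)                            ≡⟨ ∑-one Fs ⟨
        ∑ Fs (λ _ → 1ℤ)                            ≡⟨ ∑-enumerates _≟ˢ_ (subsets! m) ∈-subsets isTwoForest? Fs-enum (λ _ → 1ℤ) ⟩
        ∑ 𝒫 (λ F → 𝟙 (isTwoForest? F) * 1ℤ)       ≡⟨ ∑-cong 𝒫 (λ F → *-identityʳ (𝟙 (isTwoForest? F))) ⟩
        twoForestCount                             ∎

      cut-∑ : ∀ F → F ∈ˡ Fs → pos (cut F) ≡ ∑ E (λ e → 𝟙 (inCut? F e))
      cut-∑ F F∈ with cut-size F F∈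
      ... | es , es-enum , ∣es∣ = begin-equality
        pos (cut F)                          ≡⟨ cong pos ∣es∣ ⟨
        pos (length es)                      ≡⟨ ∑-one es ⟨
        ∑ es (λ _ → 1ℤ)                      ≡⟨ ∑-enumerates _≟_ (allFin⁺ m) ∈-allFin (inCut? F) es-enum (λ _ → 1ℤ) ⟩
        ∑ E (λ e → 𝟙 (inCut? F e) * 1ℤ)      ≡⟨ ∑-cong E (λ e → *-identityʳ (𝟙 (inCut? F e))) ⟩
        ∑ E (λ e → 𝟙 (inCut? F e))           ∎

      ∑-cut : pos (sum (map cut Fs)) ≡ ∑ E t
      ∑-cut = begin-equality
        pos (sum (map cut Fs))
          ≡⟨ ∑-sum Fs cut ⟩
        ∑ Fs (λ F → pos (cut F))
          ≡⟨ ∑-cong-∈ Fs cut-∑ ⟩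
        ∑ Fs (λ F → ∑ E (λ e → 𝟙 (inCut? F e)))
          ≡⟨ ∑-enumerates _≟ˢ_ (subsets! m) ∈-subsets isTwoForest? Fs-enum (λ F → ∑ E (λ e → 𝟙 (inCut? F e))) ⟩
        ∑ 𝒫 (λ F → 𝟙 (isTwoForest? F) * ∑ E (λ e → 𝟙 (inCut? F e)))
          ≡⟨ ∑-cong 𝒫 (λ F → ∑-*ˡ E (𝟙 (isTwoForest? F)) (λ e → 𝟙 (inCut? F e))) ⟨
        ∑ 𝒫 (λ F → ∑ E (λ e → 𝟙 (isTwoForest? F) * 𝟙 (inCut? F e)))
          -- A two-forest with `e` in its cut set is the same as a forest rooted at the two ends of
          -- `e`, so each edge contributes `t e` once the sums are exchanged.
          ≡⟨ ∑-cong 𝒫 (λ F → ∑-cong E (λ e → 𝟙-× (isTwoForest? F) (inCut? F e) (rootedForest? (src e ∷ tgt e ∷ []) F)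
               (λ S → rooted⇒twoForest S , rooted⇒separated S) separated⇒rooted)) ⟩
        ∑ 𝒫 (λ F → ∑ E (λ e → 𝟙 (rootedForest? (src e ∷ tgt e ∷ []) F)))
          ≡⟨ ∑-swap 𝒫 E (λ F e → 𝟙 (rootedForest? (src e ∷ tgt e ∷ []) F)) ⟩
        ∑ E t ∎

      cut-bound : ∀ k → n ≡ suc k → sum (map cut Fs) ℕ.* k ℕ.≤ m ℕ.* (4 ℕ.* length Fs)
      cut-bound k n≡1+k = ℤ.drop‿+≤+ (begin
        pos (sum (map cut Fs) ℕ.* k)       ≡⟨ ℤ.pos-* (sum (map cut Fs)) k ⟩
        pos (sum (map cut Fs)) * pos k     ≡⟨ cong (_* pos k) ∑-cut ⟩
        ∑ E t * (pos (suc k) - 1ℤ)         ≡⟨ cong (λ x → ∑ E t * (pos x - 1ℤ)) n≡1+k ⟨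
        ∑ E t * (pos n - 1ℤ)               ≤⟨ ∑t-bound ⟩
        pos m * (pos 4 * twoForestCount)   ≡⟨ cong (λ x → pos m * (pos 4 * x)) length-Fs ⟨
        pos m * (pos 4 * pos (length Fs))  ≡⟨ cong (pos m *_) (ℤ.pos-* 4 (length Fs)) ⟨
        pos m * pos (4 ℕ.* length Fs)      ≡⟨ ℤ.pos-* m (4 ℕ.* length Fs) ⟨
        pos (m ℕ.* (4 ℕ.* length Fs))      ∎)

open import Data.Nat using (suc; _+_; _*_; _∸_; _≤_)
open import Data.Nat.Properties using (*-monoʳ-≤)
open import Data.Nat.Tactic.RingSolver using (solve-∀)
open import Data.Fin using (zero)
open import Relation.Binary.PropositionalEquality using (_≡_; refl; subst₂)

theorem6p2 : (n m : ℕ) (G : Multigraph n m) → 2 ≤ n → Connected G →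
    (Fs : List (Subset m)) → Enumerates (IsTwoForest G) Fs →
    (cut : Subset m → ℕ) → (∀ F → F ∈ˡ Fs → HasSize (InCut G F) (cut F)) →
    sum (map cut Fs) * (n * (n ∸ 1)) ≤ 2 * (2 * m) * ((n ∸ 1) + 1) * length Fs
theorem6p2 (suc k) m G 2≤n connected Fs Fs-enum cut cut-size =
  -- Here n is `suc k`, so `zero` can serve as the root. Multiplying the bound by n restores the
  -- factor |V| that cancels between the average degree and 1 + 1/(|V| - 1).
  subst₂ _≤_ (left (sum (map cut Fs)) k) (right m k (length Fs))
    (*-monoʳ-≤ (suc k) (Counts.CutSizes.cut-bound G connected zero Fs-enum cut cut-size k refl))
  where
  left : ∀ s k → suc k * (s * k) ≡ s * (suc k * k)
  left = solve-∀
  right : ∀ m k l → suc k * (m * (4 * l)) ≡ 2 * (2 * m) * (k + 1) * l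
  right = solve-∀
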